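{- \textsc{Erd\H{o}s-Ko-Rado} is PPP-complete: \textsc{Collision} polynomial-time reduces to \textsc{Erd\H{o}s-Ko-Rado}, and \textsc{Erd\H{o}s-Ko-Rado} polynomial-time reduces to \textsc{Collision}.
   Context: All circuits are Boolean circuits of size polynomial in $n$. A search problem $A$ polynomial-time reduces to a search problem $B$ if there are polynomial-time computable maps $f,g$ such that for every instance $I$ of $A$, $f(I)$ is an instance of $B$, and for every solution $s$ of $f(I)$, $g(I,s)$ is a solution of $I$. \textsc{Collision}: given a poly($n$)-size circuit $C:\{0,1\}^n\to\{0,1\}^n$, find either $x$ with $C(x)=0^n$, or $x\neq y$ with $C(x)=C(y)$. PPP is the class of search problems polynomial-time reducible to \textsc{Collision}; PPP-complete means in PPP and PPP-hard (i.e. \textsc{Collision} reduces to it). \textsc{Erd\H{o}s-Ko-Rado}: the ground set is $\{0,1\}^n$. The input is a poly($n$)-size circuit $F:\{0,1\}^n\to(\{0,1\}^n)^2$, where $F(i)=(x,y)$ is meant to represent the $2$-element set $\{x,y\}$ (so $F$ represents a family of $2^n$ two-element subsets). A solution is one of: (1) an index $i$ with $F(i)=(x,x)$ for some $x$ (an invalid set); (2) two distinct indices $i\neq j$ such that $F(i)$ and $F(j)$ represent the same set (a repeated set); (3) two indices $i,j$ such that the sets represented by $F(i)$ and $F(j)$ are disjoint. -}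

module Defs where

open import Data.Bool as Bool using (Bool; true; false; _∧_; _∨_)
open import Data.Fin using (Fin; zero; suc; toℕ; _↑ʳ_)
open import Data.Fin.Properties using (toℕ-injective)
open import Data.List as List using (List; []; _∷_; _++_; length)
open import Data.List.Properties using (∷-injectiveˡ; ∷-injectiveʳ; ++-assoc)
open import Data.Maybe using (Maybe; just; nothing)
open import Data.Nat using (ℕ; zero; suc; _+_; _*_; _≤_)
open import Data.Nat.Properties using (≤-irrelevant)
open import Data.Product using (Σ; ∃₂; ∃-syntax; _×_; _,_; proj₁)
open import Data.Vec as Vec using (Vec; []; _∷_; lookup; replicate; toList)
open import Function using (Injective; _∘_)
open import Level using (0ℓ)
open import Relation.Binary.PropositionalEquality
  using (_≡_; _≢_; refl; cong; trans; sym)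
open import Relation.Unary using (Pred; ｛_｝; _∪_; _≐_; _⊥_)

-- Coefficient lists, constant term first.
Poly : Set
Poly = List ℕ

evalPoly : Poly → ℕ → ℕ
evalPoly []       n = 0
evalPoly (c ∷ cs) n = c + n * evalPoly cs n

String : Set
String = List Bool

-- `nothing` is the blank.
Symbol : Set
Symbol = Maybe Bool

data Move : Set where
  left stay right : Move

-- A two-way infinite tape.  `before` lists the cells to the left of the head,
-- nearest first; all cells not listed are blank.
record Tape : Set where
  constructor tape
  field
    before : List Symbol
    head   : Symbol
    after  : List Symbol

emptyTape : Tape
emptyTape = tape [] nothing []

inputTape : String → Tape
inputTape []       = emptyTape
inputTape (b ∷ bs) = tape [] (just b) (List.map just bs)

write : Symbol → Tape → Tape
write s (tape ls _ rs) = tape ls s rs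

move : Move → Tape → Tape
move stay  t                    = t
move left  (tape []       h rs) = tape [] nothing (h ∷ rs)
move left  (tape (l ∷ ls) h rs) = tape ls l (h ∷ rs)
move right (tape ls h [])       = tape (h ∷ ls) nothing []
move right (tape ls h (r ∷ rs)) = tape (h ∷ ls) r rs

bitsUntilBlank : List Symbol → String
bitsUntilBlank []             = []
bitsUntilBlank (nothing ∷ _)  = []
bitsUntilBlank (just b  ∷ ss) = b ∷ bitsUntilBlank ss

readTape : Tape → String
readTape (tape _ h rs) = bitsUntilBlank (h ∷ rs)

-- The tapes are, in order: m input tapes, one output tape, the work tapes.
-- All tapes may be read and written.  The machine halts when the transition
-- function yields `nothing`.
record TuringMachine (m : ℕ) : Set where
  field
    workTapes : ℕ
    states    : ℕ

  tapes : ℕ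
  tapes = m + suc workTapes

  field
    start      : Fin states
    transition : Fin states → Vec Symbol tapes →
                 Maybe (Fin states × Vec (Symbol × Move) tapes)

module _ {m : ℕ} (M : TuringMachine m) where
  open TuringMachine M

  record Config : Set where
    constructor config
    field
      state    : Fin states
      contents : Vec Tape tapes

  initial : Vec String m → Config
  initial ws =
    config start (Vec.map inputTape ws Vec.++ replicate (suc workTapes) emptyTape)

  act : Symbol × Move → Tape → Tape
  act (s , d) = move d ∘ write s

  step : Config → Maybe Config
  step (config q ts) with transition q (Vec.map Tape.head ts)
  ... | nothing        = nothing
  ... | just (q′ , as) = just (config q′ (Vec.zipWith act as ts))

  output : Config → String
  output (config _ ts) = readTape (lookup ts (m ↑ʳ zero))

  data HaltsIn : ℕ → Config → Config → Set where
    halted : ∀ {c} → step c ≡ nothing → HaltsIn 0 c c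
    next   : ∀ {t c c′ d} → step c ≡ just c′ → HaltsIn t c′ d → HaltsIn (suc t) c d

totalLength : ∀ {m} → Vec String m → ℕ
totalLength = Vec.sum ∘ Vec.map length

-- Polynomial-time computability of a map with domain X, where the argument is
-- presented as m strings and the value as one string.
PolyTime : ∀ {m} {X : Set} → (X → Vec String m) → (X → String) → Set
PolyTime {m} {X} input result =
  Σ (TuringMachine m) λ M → Σ Poly λ p → (x : X) →
    ∃₂ λ t c → t ≤ evalPoly p (totalLength (input x))
             × HaltsIn M t (initial M (input x)) c
             × output M c ≡ result x

record SearchProblem : Set₁ where
  field
    Instance      : Set
    instanceCode  : Instance → String
    instanceCode-injective : Injective _≡_ _≡_ instanceCode

    -- The objects among which solutions of a given instance are sought.
    Candidate     : Instance → Set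
    candidateCode : ∀ {I} → Candidate I → String
    candidateCode-injective : ∀ {I} → Injective _≡_ _≡_ (candidateCode {I})

    IsSolution    : (I : Instance) → Candidate I → Set

record _≤ₚ_ (A B : SearchProblem) : Set where
  private
    module A = SearchProblem A
    module B = SearchProblem B
  field
    f : A.Instance → B.Instance
    g : (I : A.Instance) → B.Candidate (f I) → A.Candidate I

    f-polyTime : PolyTime (λ I → A.instanceCode I ∷ []) (λ I → B.instanceCode (f I))
    g-polyTime : PolyTime {X = Σ A.Instance λ I → B.Candidate (f I)}
                          (λ (I , s) → A.instanceCode I ∷ B.candidateCode s ∷ [])
                          (λ (I , s) → A.candidateCode (g I s))

    g-correct  : ∀ I s → B.IsSolution (f I) s → A.IsSolution I (g I s)

infix 4 _≤ₚ_ _≼_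

-- A problem about poly(n)-size circuits is a family indexed by the polynomial
-- that bounds the size of the circuits.
PolySizeProblem : Set₁
PolySizeProblem = Poly → SearchProblem

_≼_ : PolySizeProblem → PolySizeProblem → Set
A ≼ B = ∀ p → ∃[ q ] (A p ≤ₚ B q)

-- A gate reading from w available wires.
data Gate (w : ℕ) : Set where
  const   : Bool → Gate w
  not     : Fin w → Gate w
  and or  : Fin w → Fin w → Gate w

-- `Circuit w m` is the rest of a circuit with m outputs once w wires are
-- available; in particular `Circuit n m` is a circuit with n inputs.  The wire
-- created by a gate becomes wire 0 and the earlier ones are shifted by one.
data Circuit : ℕ → ℕ → Set where
  outputs : ∀ {w m} → Vec (Fin w) m → Circuit w m
  _▹_     : ∀ {w m} → Gate w → Circuit (suc w) m → Circuit w m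

infixr 5 _▹_

size : ∀ {w m} → Circuit w m → ℕ
size (outputs _) = 0
size (_ ▹ C)     = suc (size C)

BitVec : ℕ → Set
BitVec = Vec Bool

evalGate : ∀ {w} → Gate w → BitVec w → Bool
evalGate (const b) ρ = b
evalGate (not i)   ρ = Bool.not (lookup ρ i)
evalGate (and i j) ρ = lookup ρ i ∧ lookup ρ j
evalGate (or i j)  ρ = lookup ρ i ∨ lookup ρ j

eval : ∀ {w m} → Circuit w m → BitVec w → BitVec m
eval (outputs os) ρ = Vec.map (lookup ρ) os
eval (g ▹ C)      ρ = eval C (evalGate g ρ ∷ ρ)

unary : ℕ → String
unary zero    = false ∷ []
unary (suc n) = true ∷ unary n

wireCode : ∀ {w} → Fin w → String
wireCode = unary ∘ toℕ

wiresCode : ∀ {w m} → Vec (Fin w) m → String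
wiresCode []       = []
wiresCode (i ∷ is) = wireCode i ++ wiresCode is

gateCode : ∀ {w} → Gate w → String
gateCode (const b) = false ∷ false ∷ b ∷ []
gateCode (not i)   = false ∷ true ∷ wireCode i
gateCode (and i j) = true ∷ false ∷ wireCode i ++ wireCode j
gateCode (or i j)  = true ∷ true ∷ wireCode i ++ wireCode j

circuitCode : ∀ {w m} → Circuit w m → String
circuitCode (outputs os) = false ∷ wiresCode os
circuitCode (g ▹ C)      = true ∷ gateCode g ++ circuitCode C

PrefixFree : {X : Set} → (X → String) → Set
PrefixFree code = ∀ x y {r s} → code x ++ r ≡ code y ++ s → x ≡ y × r ≡ s

prefixFree⇒injective : {X : Set} {code : X → String} →
                       PrefixFree code → Injective _≡_ _≡_ code
prefixFree⇒injective pf {x} {y} eq = proj₁ (pf x y (cong (_++ []) eq))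

private
  assoc₂ : ∀ (a b c d : String) {r s} →
           (a ++ b) ++ r ≡ (c ++ d) ++ s → a ++ (b ++ r) ≡ c ++ (d ++ s)
  assoc₂ a b c d eq = trans (sym (++-assoc a b _)) (trans eq (++-assoc c d _))

  pair : {X Y : Set} {c : X → String} {d : Y → String} →
         PrefixFree c → PrefixFree d → ∀ x y x′ y′ {r s} →
         (c x ++ d y) ++ r ≡ (c x′ ++ d y′) ++ s → x ≡ x′ × y ≡ y′ × r ≡ s
  pair {c = c} {d} pc pd x y x′ y′ eq
    with refl , eq₁ ← pc x x′ (assoc₂ (c x) (d y) (c x′) (d y′) eq)
    with refl , eq₂ ← pd y y′ eq₁ = refl , refl , eq₂

unary-prefixFree : PrefixFree unary
unary-prefixFree zero    zero    eq = refl , ∷-injectiveʳ eq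
unary-prefixFree (suc m) (suc n) eq
  with refl , eq′ ← unary-prefixFree m n (∷-injectiveʳ eq) = refl , eq′

wire-prefixFree : ∀ {w} → PrefixFree (wireCode {w})
wire-prefixFree i j eq
  with eq₁ , eq₂ ← unary-prefixFree (toℕ i) (toℕ j) eq =
  toℕ-injective eq₁ , eq₂

wires-prefixFree : ∀ {w m} → PrefixFree (wiresCode {w} {m})
wires-prefixFree []       []       eq = refl , eq
wires-prefixFree (i ∷ is) (j ∷ js) eq
  with refl , refl , eq′ ← pair wire-prefixFree wires-prefixFree i is j js eq = refl , eq′

gate-prefixFree : ∀ {w} → PrefixFree (gateCode {w})
gate-prefixFree (const _) (const _) refl = refl , refl
gate-prefixFree (not i) (not j) eq
  with refl , eq′ ← wire-prefixFree i j (∷-injectiveʳ (∷-injectiveʳ eq)) = refl , eq′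
gate-prefixFree (and i j) (and k l) eq
  with refl , refl , eq′ ← pair wire-prefixFree wire-prefixFree i j k l
                             (∷-injectiveʳ (∷-injectiveʳ eq)) = refl , eq′
gate-prefixFree (or i j) (or k l) eq
  with refl , refl , eq′ ← pair wire-prefixFree wire-prefixFree i j k l
                             (∷-injectiveʳ (∷-injectiveʳ eq)) = refl , eq′

circuit-prefixFree : ∀ {w m} → PrefixFree (circuitCode {w} {m})
circuit-prefixFree (outputs os) (outputs os′) eq
  with refl , eq′ ← wires-prefixFree os os′ (∷-injectiveʳ eq) = refl , eq′
circuit-prefixFree (g ▹ C) (g′ ▹ C′) eq
  with refl , eq₁ ← gate-prefixFree g g′
                      (assoc₂ (gateCode g) (circuitCode C) (gateCode g′) (circuitCode C′)
                        (∷-injectiveʳ eq))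
  with refl , eq₂ ← circuit-prefixFree C C′ eq₁ = refl , eq₂

bits-prefixFree : ∀ {n} → PrefixFree (toList {A = Bool} {n})
bits-prefixFree []       []       eq = refl , eq
bits-prefixFree (x ∷ xs) (y ∷ ys) eq
  with refl ← ∷-injectiveˡ eq
  with refl , eq′ ← bits-prefixFree xs ys (∷-injectiveʳ eq) = refl , eq′

record BoundedCircuit (out : ℕ → ℕ) (p : Poly) : Set where
  constructor bounded
  field
    n       : ℕ
    circuit : Circuit n (out n)
    size≤   : size circuit ≤ evalPoly p n

module _ {out : ℕ → ℕ} {p : Poly} where

  boundedCode : BoundedCircuit out p → String
  boundedCode (bounded n C _) = unary n ++ circuitCode C

  boundedCode-injective : Injective _≡_ _≡_ boundedCode
  boundedCode-injective {bounded n C le} {bounded n′ C′ le′} eq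
    with refl , eq′ ← unary-prefixFree n n′ eq
    with refl ← prefixFree⇒injective circuit-prefixFree eq′ =
    cong (bounded n C) (≤-irrelevant le le′)

data CollisionCandidate (n : ℕ) : Set where
  preimage : BitVec n → CollisionCandidate n
  collide  : BitVec n → BitVec n → CollisionCandidate n

collisionCode : ∀ {n} → CollisionCandidate n → String
collisionCode (preimage x)  = false ∷ toList x
collisionCode (collide x y) = true ∷ toList x ++ toList y

collisionCode-prefixFree : ∀ {n} → PrefixFree (collisionCode {n})
collisionCode-prefixFree (preimage x) (preimage y) eq
  with refl , eq′ ← bits-prefixFree x y (∷-injectiveʳ eq) = refl , eq′
collisionCode-prefixFree (collide x y) (collide x′ y′) eq
  with refl , refl , eq′ ← pair bits-prefixFree bits-prefixFree x y x′ y′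
                             (∷-injectiveʳ eq) = refl , eq′

CollisionSolution : ∀ {n} → Circuit n n → CollisionCandidate n → Set
CollisionSolution {n} C (preimage x)  = eval C x ≡ replicate n false
CollisionSolution     C (collide x y) = x ≢ y × eval C x ≡ eval C y

Collision : PolySizeProblem
Collision p = record
  { Instance                = BoundedCircuit (λ n → n) p
  ; instanceCode            = boundedCode
  ; instanceCode-injective  = boundedCode-injective
  ; Candidate               = CollisionCandidate ∘ BoundedCircuit.n
  ; candidateCode           = collisionCode
  ; candidateCode-injective = prefixFree⇒injective collisionCode-prefixFree
  ; IsSolution              = λ I → CollisionSolution (BoundedCircuit.circuit I)
  }

-- The first n output bits are x and the last n are y, where F(i) = (x , y).
evalPair : ∀ {n} → Circuit n (n + n) → BitVec n → BitVec n × BitVec n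
evalPair {n} F i = Vec.take n (eval F i) , Vec.drop n (eval F i)

SetOf : ∀ {n} → BitVec n × BitVec n → Pred (BitVec n) 0ℓ
SetOf (x , y) = ｛ x ｝ ∪ ｛ y ｝

data EKRCandidate (n : ℕ) : Set where
  invalid           : BitVec n → EKRCandidate n
  repeated disjoint : BitVec n → BitVec n → EKRCandidate n

ekrCode : ∀ {n} → EKRCandidate n → String
ekrCode (invalid i)    = false ∷ toList i
ekrCode (repeated i j) = true ∷ false ∷ toList i ++ toList j
ekrCode (disjoint i j) = true ∷ true ∷ toList i ++ toList j

ekrCode-prefixFree : ∀ {n} → PrefixFree (ekrCode {n})
ekrCode-prefixFree (invalid i) (invalid j) eq
  with refl , eq′ ← bits-prefixFree i j (∷-injectiveʳ eq) = refl , eq′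
ekrCode-prefixFree (repeated i j) (repeated k l) eq
  with refl , refl , eq′ ← pair bits-prefixFree bits-prefixFree i j k l
                             (∷-injectiveʳ (∷-injectiveʳ eq)) = refl , eq′
ekrCode-prefixFree (disjoint i j) (disjoint k l) eq
  with refl , refl , eq′ ← pair bits-prefixFree bits-prefixFree i j k l
                             (∷-injectiveʳ (∷-injectiveʳ eq)) = refl , eq′

EKRSolution : ∀ {n} → Circuit n (n + n) → EKRCandidate n → Set
EKRSolution F (invalid i)    = ∃[ x ] evalPair F i ≡ (x , x)
EKRSolution F (repeated i j) = i ≢ j × SetOf (evalPair F i) ≐ SetOf (evalPair F j)
EKRSolution F (disjoint i j) = SetOf (evalPair F i) ⊥ SetOf (evalPair F j)

ErdősKoRado : PolySizeProblem
ErdősKoRado p = record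
  { Instance                = BoundedCircuit (λ n → n + n) p
  ; instanceCode            = boundedCode
  ; instanceCode-injective  = boundedCode-injective
  ; Candidate               = EKRCandidate ∘ BoundedCircuit.n
  ; candidateCode           = ekrCode
  ; candidateCode-injective = prefixFree⇒injective ekrCode-prefixFree
  ; IsSolution              = λ I → EKRSolution (BoundedCircuit.circuit I)
  }

InPPP : PolySizeProblem → Set
InPPP A = A ≼ Collision

PPP-hard : PolySizeProblem → Set
PPP-hard A = Collision ≼ A

PPP-complete : PolySizeProblem → Set
PPP-complete A = PPP-hard A × InPPP A

module Submission where

open import Defs

-- Two sets {x, y} and {x′, y′} with x ⊻ y = x′ ⊻ y′ (bitwise xor) are equal or disjoint, and
-- x ⊻ y = 0 forces x = y. Hence i ↦ x ⊻ y, where F(i) = (x, y), reduces Erdős–Ko–Rado to Collision: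
-- a zero is an invalid set, and a collision is a repeated set or a pair of disjoint sets, which is
-- decided by evaluating F at both indices. Conversely, the sets {0ⁿ, C(i)} are never disjoint, and
-- two of them are equal only if the values of C are.
--
-- For polynomial-time computability, a tape is used as a stack whose top is under the head. The four
-- maps are computed by structured programs on stacks, which are compiled to Turing machines.

open import Data.Bool as Bool using (Bool; true; false; if_then_else_; _xor_)
open import Data.Bool.Properties using (xor-comm)
open import Data.Empty using (⊥-elim)
open import Data.Fin using (Fin; zero; suc; _↑ʳ_; toℕ; #_)
open import Data.Fin.Patterns using (0F; 1F; 2F; 3F; 4F; 5F; 6F; 7F; 8F; 9F)
open import Data.Fin.Properties using (+↔⊎; 1↔⊤; 2↔Bool; toℕ-↑ʳ; toℕ<n)
open import Data.List as List using (List; []; _∷_; _++_; _ʳ++_; length; drop)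
open import Data.List.Properties
  using (++-assoc; ++-ʳ++; ʳ++-ʳ++; ++-identityʳ; length-++; length-replicate; length-ʳ++)
open import Data.List.Relation.Unary.All using (All; []; _∷_)
open import Data.Maybe as Maybe using (Maybe; just; nothing; maybe′; is-just; fromMaybe)
open import Data.Nat using (ℕ; zero; suc; _+_; _*_; _≤_; z≤n; s≤s)
open import Data.Nat.Properties
open import Data.Nat.Solver using (module +-*-Solver)
open import Data.Product using (∃₂; ∃-syntax; _×_; _,_; proj₁; proj₂)
open import Data.Sum using (_⊎_; inj₁; inj₂; swap)
open import Data.Sum.Function.Propositional using (_⊎-↔_)
open import Data.Unit using (⊤; tt)
open import Data.Vec as Vec using (Vec; []; _∷_; lookup; updateAt; replicate; toList; _[_]≔_)
open import Data.Vec.Properties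
  using (lookup-map; updateAt-id-local; updateAt-updateAt; updateAt-commutes; updateAt-cong;
    updateAt-cong-local; lookup∘updateAt; lookup∘updateAt′; map-∘; map-cong; map-++;
    map-replicate; take-map; drop-map; take++drop≡id; length-toList; zipWith-comm)
open import Data.Vec.Relation.Binary.Pointwise.Inductive as Pointwise using (Pointwise; []; _∷_)
open import Function using (_∘_; id; _↔_; Inverse)
open import Function.Properties.Inverse using (↔-trans)
open import Relation.Binary.PropositionalEquality
open import Relation.Unary using (_≐_; _⊥_)

-- Programs on stacks of bits

-- Xor is the right combination because it is symmetric, so that it depends on the set and not on
-- the order of the pair, and because it cancels, so that in two sets with the same value one common
-- element forces the other elements to agree. The instance maps have to transform codes of
-- circuits. New gates are only appended, so a program copies the original gates verbatim and
-- rewrites nothing but the list of outputs. Stacks dictate the shape of the programs: a word can be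
-- read through only by popping it, and moving it to another stack reverses it. Results are
-- therefore built in reverse and moved once more, and whatever is needed again (counters,
-- candidates, halves of an output) is pushed onto a second stack while it is read. The semantics
-- `_⊢_⇓[_]_` yields final stacks and running time together, so a single simulation proof serves all
-- four maps.

infixr 5 _⨾_

data Prog (k : ℕ) : Set where
  skip  : Prog k
  push  : Fin k → Bool → Prog k
  pop   : Fin k → Prog k
  _⨾_   : Prog k → Prog k → Prog k
  case  : Fin k → (Symbol → Prog k) → Prog k
  while : Fin k → (Symbol → Bool) → Prog k → Prog k

-- Running time of m rounds, each consisting of a test and a body taking b steps,
-- followed by a failing test.
rounds : ℕ → ℕ → ℕ
rounds zero    b = 1
rounds (suc m) b = suc (b + rounds m b)

rounds-≡ : ∀ m b → rounds m b ≡ 1 + m * (1 + b)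
rounds-≡ zero    b = refl
rounds-≡ (suc m) b rewrite rounds-≡ m b = cong suc (+-suc b (m * suc b))

rounds-mono : ∀ {m n b c} → m ≤ n → b ≤ c → rounds m b ≤ rounds n c
rounds-mono {m} {n} {b} {c} m≤n b≤c rewrite rounds-≡ m b | rounds-≡ n c =
  s≤s (*-mono-≤ m≤n (s≤s b≤c))

infix 4 _⊢_⇓[_]_

-- The index t is only an upper bound on the number of machine steps.
data _⊢_⇓[_]_ {k} : Prog k → Vec String k → ℕ → Vec String k → Set where
  skip   : ∀ {s} → skip ⊢ s ⇓[ 1 ] s
  push   : ∀ {i b s} → push i b ⊢ s ⇓[ 2 ] updateAt s i (b ∷_)
  pop    : ∀ {i s} → pop i ⊢ s ⇓[ 1 ] updateAt s i (drop 1)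
  _⨾_    : ∀ {p q s s′ s″ t t′} → p ⊢ s ⇓[ t ] s′ → q ⊢ s′ ⇓[ t′ ] s″ →
           p ⨾ q ⊢ s ⇓[ t + t′ ] s″
  case   : ∀ {i f s s′ t} → f (List.head (lookup s i)) ⊢ s ⇓[ t ] s′ →
           case i f ⊢ s ⇓[ suc t ] s′
  stop   : ∀ {i c p s} → c (List.head (lookup s i)) ≡ false → while i c p ⊢ s ⇓[ 1 ] s
  loop   : ∀ {i c p s s′ s″ t t′} → c (List.head (lookup s i)) ≡ true →
           p ⊢ s ⇓[ t ] s′ → while i c p ⊢ s′ ⇓[ t′ ] s″ →
           while i c p ⊢ s ⇓[ suc (t + t′) ] s″
  weaken : ∀ {p s s′ t t′} → t ≤ t′ → p ⊢ s ⇓[ t ] s′ → p ⊢ s ⇓[ t′ ] s′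

private
  length-updateAt : ∀ {k} {f : String → String} {t} (s : Vec String k) i j →
    (∀ w → length (f w) ≤ length w + t) →
    length (lookup (updateAt s i f) j) ≤ length (lookup s j) + t
  length-updateAt (w ∷ s) zero    zero    h = h w
  length-updateAt (w ∷ s) zero    (suc j) h = m≤m+n _ _
  length-updateAt (w ∷ s) (suc i) zero    h = m≤m+n _ _
  length-updateAt (w ∷ s) (suc i) (suc j) h = length-updateAt s i j h

  ≤-+-trans : ∀ {a b c} t t′ → b ≤ a + t → c ≤ b + t′ → c ≤ a + (t + t′)
  ≤-+-trans {a} t t′ p q =
    ≤-trans q (≤-trans (+-monoˡ-≤ t′ p) (≤-reflexive (+-assoc a t t′)))

  ≤-+-suc : ∀ {a b t} → b ≤ a + t → b ≤ a + suc t
  ≤-+-suc {a} p = ≤-trans p (+-monoʳ-≤ a (n≤1+n _))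

-- Every push is charged time, so a time bound is also a bound on growth. This later bounds the
-- length of a result without computing it, see `⇓-then-transfer`.
⇓-length : ∀ {k} {p : Prog k} {s t s′} → p ⊢ s ⇓[ t ] s′ →
           ∀ j → length (lookup s′ j) ≤ length (lookup s j) + t
⇓-length skip j = m≤m+n _ _
⇓-length (push {i} {b} {s}) j =
  length-updateAt s i j (λ w → ≤-trans (n≤1+n _) (≤-reflexive (+-comm 2 (length w))))
⇓-length (pop {i} {s}) j =
  length-updateAt s i j (λ { [] → z≤n ; (_ ∷ w) → ≤-trans (n≤1+n _) (m≤m+n _ _) })
⇓-length (_⨾_ {t = t} {t′} d e) j = ≤-+-trans t t′ (⇓-length d j) (⇓-length e j)
⇓-length (case d) j = ≤-+-suc (⇓-length d j)
⇓-length (stop _) j = m≤m+n _ _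
⇓-length (loop {t = t} {t′} _ d e) j =
  ≤-+-suc (≤-+-trans t t′ (⇓-length d j) (⇓-length e j))
⇓-length (weaken t≤t′ d) j = ≤-trans (⇓-length d j) (+-monoʳ-≤ _ t≤t′)

-- Compilation to Turing machines

Actions : ℕ → Set
Actions k = Vec (Symbol × Move) k

-- A machine step writes before it moves, so a push needs two control points: one steps left to the
-- new top cell, the other writes there. The summand `⊤` in `case` and `while` is the test.
Point : ∀ {k} → Prog k → Set
Point skip          = ⊤
Point (push _ _)    = Bool
Point (pop _)       = ⊤
Point (p ⨾ q)       = Point p ⊎ Point q
Point (case _ f)    = ⊤ ⊎ (Point (f nothing) ⊎ (Point (f (just false)) ⊎ Point (f (just true))))
Point (while _ _ p) = ⊤ ⊎ Point p

entry : ∀ {k} (p : Prog k) → Point p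
entry skip          = tt
entry (push _ _)    = false
entry (pop _)       = tt
entry (p ⨾ q)       = inj₁ (entry p)
entry (case _ _)    = inj₁ tt
entry (while _ _ _) = inj₁ tt

branch : ∀ {k i} (f : Symbol → Prog k) a → Point (f a) → Point (case i f)
branch f nothing      = inj₂ ∘ inj₁
branch f (just false) = inj₂ ∘ inj₂ ∘ inj₁
branch f (just true)  = inj₂ ∘ inj₂ ∘ inj₂

idle : ∀ {k} → Vec Symbol k → Actions k
idle = Vec.map (_, stay)

redirect : ∀ {A B C : Set} → (A → B) → B → Maybe A × C → Maybe B × C
redirect ι x (a , c) = just (maybe′ ι x a) , c

extend : ∀ {A B C : Set} → (A → B) → Maybe A × C → Maybe B × C
extend ι (a , c) = Maybe.map ι a , c

-- `nothing` means that control leaves the program.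
δ : ∀ {k} (p : Prog k) → Point p → Vec Symbol k → Maybe (Point p) × Actions k
δ skip          _        h = nothing , idle h
δ (push i b)    false    h = just true , idle h [ i ]≔ (lookup h i , left)
δ (push i b)    true     h = nothing , idle h [ i ]≔ (just b , stay)
δ (pop i)       _        h = nothing , idle h [ i ]≔ (nothing , right)
δ (p ⨾ q)       (inj₁ x) h = redirect inj₁ (inj₂ (entry q)) (δ p x h)
δ (p ⨾ q)       (inj₂ y) h = extend inj₂ (δ q y h)
δ (case i f)    (inj₁ _) h =
  just (branch {i = i} f (lookup h i) (entry (f (lookup h i)))) , idle h
δ (case i f)    (inj₂ (inj₁ x))        h =
  extend (branch {i = i} f nothing) (δ (f nothing) x h)
δ (case i f)    (inj₂ (inj₂ (inj₁ x))) h =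
  extend (branch {i = i} f (just false)) (δ (f (just false)) x h)
δ (case i f)    (inj₂ (inj₂ (inj₂ x))) h =
  extend (branch {i = i} f (just true)) (δ (f (just true)) x h)
δ (while i c p) (inj₁ _) h =
  (if c (lookup h i) then just (inj₂ (entry p)) else nothing) , idle h
δ (while i c p) (inj₂ x) h = redirect inj₂ (inj₁ tt) (δ p x h)

finite : ∀ {k} (p : Prog k) → ∃[ n ] Fin n ↔ Point p
finite skip          = 1 , 1↔⊤
finite (push _ _)    = 2 , 2↔Bool
finite (pop _)       = 1 , 1↔⊤
finite (p ⨾ q)       = _ , ↔-trans +↔⊎ (proj₂ (finite p) ⊎-↔ proj₂ (finite q))
finite (case _ f)    =
  _ , ↔-trans +↔⊎ (1↔⊤ ⊎-↔ ↔-trans +↔⊎ (proj₂ (finite (f nothing)) ⊎-↔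
        ↔-trans +↔⊎ (proj₂ (finite (f (just false))) ⊎-↔ proj₂ (finite (f (just true))))))
finite (while _ _ p) = _ , ↔-trans +↔⊎ (1↔⊤ ⊎-↔ proj₂ (finite p))

-- `act` without its machine argument, which it ignores.
perform : Symbol × Move → Tape → Tape
perform (a , d) = move d ∘ write a

-- Requiring every cell beyond the word to be blank, and not just the next one, makes popping an
-- empty stack harmless: the head moves on to another blank.
data Holds : List Symbol → String → Set where
  blanks : ∀ {ss} → All (_≡ nothing) ss → Holds ss []
  _∷_    : ∀ b {ss w} → Holds ss w → Holds (just b ∷ ss) (b ∷ w)

-- The cells to the left of the head are irrelevant.
Represents : Tape → String → Set
Represents (tape _ h rs) w = Holds (h ∷ rs) w

represents-head : ∀ {t w} → Represents t w → Tape.head t ≡ List.head w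
represents-head (blanks (refl ∷ _)) = refl
represents-head (b ∷ _)             = refl

holds⇒read : ∀ {ss w} → Holds ss w → bitsUntilBlank ss ≡ w
holds⇒read (blanks [])         = refl
holds⇒read (blanks (refl ∷ _)) = refl
holds⇒read (b ∷ h)             = cong (b ∷_) (holds⇒read h)

represents-input : ∀ w → Represents (inputTape w) w
represents-input []      = blanks (refl ∷ [])
represents-input (b ∷ w) = b ∷ bits w
  where
  bits : ∀ w → Holds (List.map just w) w
  bits []      = blanks []
  bits (b ∷ w) = b ∷ bits w

represents-push : ∀ t {w} b → Represents t w →
                  Represents (perform (just b , stay) (perform (Tape.head t , left) t)) (b ∷ w)
represents-push (tape []      h rs) b r = b ∷ r
represents-push (tape (_ ∷ _) h rs) b r = b ∷ r

represents-pop : ∀ {t w} → Represents t w → Represents (perform (nothing , right) t) (drop 1 w)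
represents-pop {tape _ _ []}      (blanks _)            = blanks (refl ∷ [])
represents-pop {tape _ _ (_ ∷ _)} (blanks (_ ∷ all))    = blanks all
represents-pop {tape _ _ []}      (b ∷ blanks [])       = blanks (refl ∷ [])
represents-pop {tape _ _ (_ ∷ _)} (b ∷ h)               = h

heads : ∀ {k} → Vec Tape k → Vec Symbol k
heads = Vec.map Tape.head

act-idle : ∀ {k} (ts : Vec Tape k) → Vec.zipWith perform (idle (heads ts)) ts ≡ ts
act-idle []       = refl
act-idle (t ∷ ts) = cong (t ∷_) (act-idle ts)

act-one : ∀ {k} (ts : Vec Tape k) i a →
          Vec.zipWith perform (idle (heads ts) [ i ]≔ a) ts ≡ updateAt ts i (perform a)
act-one (t ∷ ts) zero    a = cong (perform a t ∷_) (act-idle ts)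
act-one (t ∷ ts) (suc i) a = cong (t ∷_) (act-one ts i a)

Pointwise-updateAt : ∀ {A B : Set} {_∼_ : A → B → Set} {k} {xs : Vec A k} {ys : Vec B k} {f g} →
  Pointwise _∼_ xs ys → ∀ i → (lookup xs i ∼ lookup ys i → f (lookup xs i) ∼ g (lookup ys i)) →
  Pointwise _∼_ (updateAt xs i f) (updateAt ys i g)
Pointwise-updateAt (r ∷ rs) zero    h = h r ∷ rs
Pointwise-updateAt (r ∷ rs) (suc i) h = r ∷ Pointwise-updateAt rs i h

module Simulation {m : ℕ} (M : TuringMachine m) where
  open TuringMachine M

  -- ι places the program p in the control of M, and x is where control goes after p.
  Embeds : (p : Prog tapes) → (Point p → Fin states) → Fin states → Set
  Embeds p ι x = ∀ z h → transition (ι z) h ≡ just (maybe′ ι x (proj₁ (δ p z h)) , proj₂ (δ p z h))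

  -- `HaltsIn` describes complete runs only, so a partial run is expressed by its effect: it can be
  -- put in front of any halting run from its end.
  record Reaches (t : ℕ) (q : Fin states) (ts : Vec Tape tapes)
                 (q′ : Fin states) (ts′ : Vec Tape tapes) : Set where
    constructor reach
    field
      prepend : ∀ {u c} → HaltsIn M u (config q′ ts′) c → HaltsIn M (t + u) (config q ts) c
  open Reaches

  reaches-step : ∀ {q q′ ts ts′ as} → transition q (heads ts) ≡ just (q′ , as) →
                 Vec.zipWith perform as ts ≡ ts′ → Reaches 1 q ts q′ ts′
  reaches-step {q} {q′} {ts} {as = as} eq refl = reach (next step-≡)
    where
    step-≡ : step M (config q ts) ≡ just (config q′ (Vec.zipWith perform as ts))
    step-≡ rewrite eq = refl

  reaches-trans : ∀ {t t′ q q′ q″ ts ts′ ts″} → Reaches t q ts q′ ts′ →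
                  Reaches t′ q′ ts′ q″ ts″ → Reaches (t + t′) q ts q″ ts″
  reaches-trans {t} {t′} r r′ .prepend {u} h
    rewrite +-assoc t t′ u = r .prepend (r′ .prepend h)

  record Simulates (t : ℕ) (q : Fin states) (ts : Vec Tape tapes)
                   (x : Fin states) (s : Vec String tapes) : Set where
    constructor simulates
    field
      {time}  : ℕ
      time≤   : time ≤ t
      {final} : Vec Tape tapes
      agree   : Pointwise Represents final s
      reaches : Reaches time q ts x final

  simulates-⨾ : ∀ {t t′ q ts y s x s′} → Simulates t q ts y s →
                (∀ {ts′} → Pointwise Represents ts′ s → Simulates t′ y ts′ x s′) →
                Simulates (t + t′) q ts x s′
  simulates-⨾ (simulates {u} t≤ ag r) k with simulates {u′} t≤′ ag′ r′ ← k ag =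
    simulates (+-mono-≤ t≤ t≤′) ag′ (reaches-trans {u} {u′} r r′)

  before-simulates : ∀ {t q ts q′ ts′ x s} → Reaches 1 q ts q′ ts′ → Simulates t q′ ts′ x s →
                     Simulates (suc t) q ts x s
  before-simulates r (simulates t≤ ag r′) =
    simulates (s≤s t≤) ag (reaches-trans {1} r r′)

  embeds-redirect : ∀ (p : Prog tapes) {A : Set} (κ : Point p → A) ι {x} y →
    (∀ z h → transition (ι (κ z)) h ≡
             just (maybe′ ι x (proj₁ (redirect κ y (δ p z h))) , proj₂ (δ p z h))) →
    Embeds p (ι ∘ κ) (ι y)
  embeds-redirect p κ ι {x} y em z h =
    trans (em z h) (cong (λ q → just (q , proj₂ (δ p z h))) (target (proj₁ (δ p z h))))
    where
    target : ∀ a → maybe′ ι x (just (maybe′ κ y a)) ≡ maybe′ (ι ∘ κ) (ι y) a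
    target (just _) = refl
    target nothing  = refl

  embeds-extend : ∀ (p : Prog tapes) {A : Set} (κ : Point p → A) ι {x} →
    (∀ z h → transition (ι (κ z)) h ≡
             just (maybe′ ι x (proj₁ (extend κ (δ p z h))) , proj₂ (δ p z h))) →
    Embeds p (ι ∘ κ) x
  embeds-extend p κ ι {x} em z h =
    trans (em z h) (cong (λ q → just (q , proj₂ (δ p z h))) (target (proj₁ (δ p z h))))
    where
    target : ∀ a → maybe′ ι x (Maybe.map κ a) ≡ maybe′ (ι ∘ κ) x a
    target (just _) = refl
    target nothing  = refl

  embeds-branch : ∀ i (f : Symbol → Prog tapes) {ι x} → Embeds (case i f) ι x →
                  ∀ a → Embeds (f a) (ι ∘ branch {i = i} f a) x
  embeds-branch i f {ι} em nothing      = embeds-extend (f nothing) _ ι (λ z → em (inj₂ (inj₁ z)))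
  embeds-branch i f {ι} em (just false) =
    embeds-extend (f (just false)) _ ι (λ z → em (inj₂ (inj₂ (inj₁ z))))
  embeds-branch i f {ι} em (just true)  =
    embeds-extend (f (just true)) _ ι (λ z → em (inj₂ (inj₂ (inj₂ z))))

  read : ∀ {ts : Vec Tape tapes} {s : Vec String tapes} → Pointwise Represents ts s → ∀ i → lookup (heads ts) i ≡ List.head (lookup s i)
  read {ts} ag i = trans (lookup-map i Tape.head ts) (represents-head {lookup ts i} (Pointwise.lookup ag i))

  test : ∀ i c (p : Prog tapes) (ι : Point (while i c p) → Fin states) x {ts : Vec Tape tapes} {s b} → Pointwise Represents ts s →
         c (List.head (lookup s i)) ≡ b →
         just (maybe′ ι x (proj₁ (δ (while i c p) (inj₁ tt) (heads ts))) , idle (heads ts)) ≡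
         just (maybe′ ι x (if b then just (inj₂ (entry p)) else nothing) , idle (heads ts))
  test i c p ι x {ts} ag eq =
    cong (λ b → just (maybe′ ι x (if b then just (inj₂ (entry p)) else nothing) , idle (heads ts)))
      (trans (cong c (read ag i)) eq)

  simulate : ∀ {p : Prog tapes} {ι x s t s′ ts} → p ⊢ s ⇓[ t ] s′ → Embeds p ι x →
             Pointwise Represents ts s → Simulates t (ι (entry p)) ts x s′
  simulate {ts = ts} skip em ag =
    simulates ≤-refl ag (reaches-step (em tt _) (act-idle ts))
  simulate {ts = ts} (push {i} {b}) em ag =
    simulates ≤-refl agree₂
      (reaches-trans {1} (reaches-step (em false _) (act-one ts i _))
                         (reaches-step (em true _) (trans (act-one _ i _) (updateAt-updateAt i ts))))
    where
    agree₂ : Pointwise Represents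
               (updateAt ts i (perform (just b , stay) ∘ perform (lookup (heads ts) i , left))) _
    agree₂ rewrite lookup-map i Tape.head ts = Pointwise-updateAt ag i (represents-push (lookup ts i) b)
  simulate {ts = ts} (pop {i}) em ag =
    simulates ≤-refl (Pointwise-updateAt ag i represents-pop)
      (reaches-step (em tt _) (act-one ts i _))
  simulate {p = p ⨾ q} {ι} {x} (d ⨾ e) em ag =
    simulates-⨾ (simulate d (embeds-redirect p inj₁ ι {x} (inj₂ (entry q)) (λ z → em (inj₁ z))) ag)
                (simulate e (embeds-extend q inj₂ ι (λ z → em (inj₂ z))))
  simulate {p = case i f} {ι} {x} {ts = ts} (case {s = s} {s′} {t} d) em ag =
    before-simulates (reaches-step (em (inj₁ tt) (heads ts)) (act-idle ts))
                     (chosen (lookup (heads ts) i) (read ag i))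
    where
    -- The machine branches on the symbol read from the tape, the derivation on the top of the
    -- stack. Abstracting the former lets the two be identified by `refl`.
    chosen : ∀ a → a ≡ List.head (lookup s i) →
             Simulates t (ι (branch {i = i} f a (entry (f a)))) ts x s′
    chosen _ refl = simulate d (embeds-branch i f em _) ag
  simulate {p = while i c p} {ι} {x} {ts = ts} (stop eq) em ag =
    simulates ≤-refl ag (reaches-step (trans (em (inj₁ tt) (heads ts)) (test i c p ι x ag eq)) (act-idle ts))
  simulate {p = while i c p} {ι} {x} {ts = ts} (loop eq d e) em ag =
    before-simulates (reaches-step (trans (em (inj₁ tt) (heads ts)) (test i c p ι x ag eq)) (act-idle ts))
      (simulates-⨾ (simulate d (embeds-redirect p inj₂ ι {x} (inj₁ tt) (λ z → em (inj₂ z))) ag)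
                   (simulate e em))
  simulate (weaken t≤t′ d) em ag with simulates t≤ ag′ r ← simulate d em ag =
    simulates (≤-trans t≤ t≤t′) ag′ r

module Compile {m w : ℕ} (p : Prog (m + suc w)) where
  private
    n = proj₁ (finite p)
    open Inverse (proj₂ (finite p)) using (to; from; strictlyInverseˡ)

  -- State `zero` has no successor.
  machine : TuringMachine m
  machine = record
    { workTapes  = w
    ; states     = suc n
    ; start      = suc (from (entry p))
    ; transition = λ
        { zero    h → nothing
        ; (suc q) h → just (maybe′ (suc ∘ from) zero (proj₁ (δ p (to q) h)) , proj₂ (δ p (to q) h)) }
    }

  open Simulation machine

  embeds : Embeds p (suc ∘ from) zero
  embeds z h rewrite strictlyInverseˡ z = refl

  private
    agree-initial : ∀ {l} (ws : Vec String l) →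
      Pointwise Represents (Vec.map inputTape ws Vec.++ replicate (suc w) emptyTape)
                           (ws Vec.++ replicate (suc w) [])
    agree-initial (v ∷ ws) = represents-input v ∷ agree-initial ws
    agree-initial []       = all (suc w)
      where
      all : ∀ l → Pointwise Represents (replicate l emptyTape) (replicate l [])
      all zero    = []
      all (suc l) = blanks (refl ∷ []) ∷ all l

  halts : ∀ {ws t s} → p ⊢ ws Vec.++ replicate (suc w) [] ⇓[ t ] s →
          ∃₂ λ u c → u ≤ t × HaltsIn machine u (initial machine ws) c ×
                     output machine c ≡ lookup s (m ↑ʳ zero)
  halts {ws} d with simulates t≤ ag r ← simulate {ι = suc ∘ from} {x = zero} d embeds (agree-initial ws) =
    _ , _ , ≤-trans (≤-reflexive (+-identityʳ _)) t≤ , Reaches.prepend r (halted refl) ,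
    holds⇒read (Pointwise.lookup ag (m ↑ʳ zero))

-- Polynomial time bounds

infixr 6 _⊕_

-- The syntax follows the programs: `⟦ e ⟧ n` unfolds to the very sums and `rounds` that index the
-- derivations, while each expression still denotes a polynomial.
data Bound : Set where
  const : ℕ → Bound
  var   : Bound
  _⊕_   : Bound → Bound → Bound
  loop  : Bound → Bound → Bound

⟦_⟧ : Bound → ℕ → ℕ
⟦ const c ⟧  n = c
⟦ var ⟧      n = n
⟦ e ⊕ e′ ⟧   n = ⟦ e ⟧ n + ⟦ e′ ⟧ n
⟦ loop e e′ ⟧ n = rounds (⟦ e ⟧ n) (⟦ e′ ⟧ n)

_+ₚ_ : Poly → Poly → Poly
[]      +ₚ q       = q
(c ∷ p) +ₚ []      = c ∷ p
(c ∷ p) +ₚ (d ∷ q) = (c + d) ∷ (p +ₚ q)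

eval-+ₚ : ∀ p q n → evalPoly (p +ₚ q) n ≡ evalPoly p n + evalPoly q n
eval-+ₚ []      q       n = refl
eval-+ₚ (c ∷ p) []      n = sym (+-identityʳ _)
eval-+ₚ (c ∷ p) (d ∷ q) n rewrite eval-+ₚ p q n =
  solve 5 (λ c d n x y → (c :+ d) :+ n :* (x :+ y) := (c :+ n :* x) :+ (d :+ n :* y)) refl
    c d n (evalPoly p n) (evalPoly q n)
  where open +-*-Solver

_*ₚ_ : Poly → Poly → Poly
[]      *ₚ q = []
(c ∷ p) *ₚ q = List.map (c *_) q +ₚ (0 ∷ (p *ₚ q))

eval-scale : ∀ c q n → evalPoly (List.map (c *_) q) n ≡ c * evalPoly q n
eval-scale c []      n = sym (*-zeroʳ c)
eval-scale c (d ∷ q) n rewrite eval-scale c q n =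
  solve 4 (λ c d n x → c :* d :+ n :* (c :* x) := c :* (d :+ n :* x)) refl c d n (evalPoly q n)
  where open +-*-Solver

eval-*ₚ : ∀ p q n → evalPoly (p *ₚ q) n ≡ evalPoly p n * evalPoly q n
eval-*ₚ []      q n = refl
eval-*ₚ (c ∷ p) q n
  rewrite eval-+ₚ (List.map (c *_) q) (0 ∷ (p *ₚ q)) n | eval-scale c q n | eval-*ₚ p q n =
  solve 4 (λ c n x y → c :* y :+ n :* (x :* y) := (c :+ n :* x) :* y) refl
    c n (evalPoly p n) (evalPoly q n)
  where open +-*-Solver

poly : Bound → Poly
poly (const c)   = c ∷ []
poly var         = 0 ∷ 1 ∷ []
poly (e ⊕ e′)    = poly e +ₚ poly e′
poly (loop e e′) = (1 ∷ []) +ₚ (poly e *ₚ ((1 ∷ []) +ₚ poly e′))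

eval-poly : ∀ e n → evalPoly (poly e) n ≡ ⟦ e ⟧ n
eval-poly (const c) n rewrite *-zeroʳ n = +-identityʳ c
eval-poly var n rewrite *-zeroʳ n = *-identityʳ n
eval-poly (e ⊕ e′) n rewrite eval-+ₚ (poly e) (poly e′) n = cong₂ _+_ (eval-poly e n) (eval-poly e′ n)
eval-poly (loop e e′) n
  rewrite eval-+ₚ (1 ∷ []) (poly e *ₚ ((1 ∷ []) +ₚ poly e′)) n
        | eval-*ₚ (poly e) ((1 ∷ []) +ₚ poly e′) n
        | eval-+ₚ (1 ∷ []) (poly e′) n
        | *-zeroʳ n | eval-poly e n | eval-poly e′ n = sym (rounds-≡ (⟦ e ⟧ n) (⟦ e′ ⟧ n))

polyTime : ∀ {m w} {X : Set} (input : X → Vec String m) {result : X → String}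
           (p : Prog (m + suc w)) (e : Bound) →
           (∀ x → ∃[ s ] (p ⊢ input x Vec.++ replicate (suc w) [] ⇓[ ⟦ e ⟧ (totalLength (input x)) ] s
                         × lookup s (m ↑ʳ zero) ≡ result x)) →
           PolyTime input result
polyTime input p e run = machine , poly e , λ x →
  let s , d , eq = run x
      u , c , u≤ , h , out = halts d
  in u , c , ≤-trans u≤ (≤-reflexive (sym (eval-poly e (totalLength (input x))))) , h , trans out eq
  where open Compile p

-- Circuits split into their gates and their output wires

endWidth : ∀ {w m} → Circuit w m → ℕ
endWidth {w} (outputs _) = w
endWidth     (_ ▹ C)     = endWidth C

endWires : ∀ {w m} (C : Circuit w m) → Vec (Fin (endWidth C)) m
endWires (outputs os) = os
endWires (_ ▹ C)      = endWires C

endEnv : ∀ {w m} (C : Circuit w m) → BitVec w → BitVec (endWidth C)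
endEnv (outputs _) ρ = ρ
endEnv (g ▹ C)     ρ = endEnv C (evalGate g ρ ∷ ρ)

gatesCode : ∀ {w m} → Circuit w m → String
gatesCode (outputs _) = []
gatesCode (g ▹ C)     = true ∷ gateCode g ++ gatesCode C

endWidth≡ : ∀ {w m} (C : Circuit w m) → endWidth C ≡ w + size C
endWidth≡ (outputs _) = sym (+-identityʳ _)
endWidth≡ (g ▹ C)     = trans (endWidth≡ C) (sym (+-suc _ _))

eval-end : ∀ {w m} (C : Circuit w m) ρ → eval C ρ ≡ Vec.map (lookup (endEnv C ρ)) (endWires C)
eval-end (outputs _) ρ = refl
eval-end (g ▹ C)     ρ = eval-end C (evalGate g ρ ∷ ρ)

circuitCode-end : ∀ {w m} (C : Circuit w m) →
                  circuitCode C ≡ gatesCode C ++ false ∷ wiresCode (endWires C)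
circuitCode-end (outputs _) = refl
circuitCode-end (g ▹ C) rewrite circuitCode-end C =
  cong (true ∷_) (sym (++-assoc (gateCode g) (gatesCode C) _))

module _ {m m′} (h : ∀ {w} → Vec (Fin w) m → Circuit w m′) where

  -- Gates placed after those of a circuit leave the earlier gate codes untouched, so `gatesCode` is
  -- a common part of the old and the new code.
  mapOutputs : ∀ {w} → Circuit w m → Circuit w m′
  mapOutputs (outputs os) = h os
  mapOutputs (g ▹ C)      = g ▹ mapOutputs C

  eval-mapOutputs : ∀ {w} (C : Circuit w m) ρ →
                    eval (mapOutputs C) ρ ≡ eval (h (endWires C)) (endEnv C ρ)
  eval-mapOutputs (outputs _) ρ = refl
  eval-mapOutputs (g ▹ C)     ρ = eval-mapOutputs C (evalGate g ρ ∷ ρ)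

  circuitCode-mapOutputs : ∀ {w} (C : Circuit w m) →
    circuitCode (mapOutputs C) ≡ gatesCode C ++ circuitCode (h (endWires C))
  circuitCode-mapOutputs (outputs _) = refl
  circuitCode-mapOutputs (g ▹ C) rewrite circuitCode-mapOutputs C =
    cong (true ∷_) (sym (++-assoc (gateCode g) (gatesCode C) _))

  size-mapOutputs : ∀ {w} (C : Circuit w m) →
                    size (mapOutputs C) ≡ size C + size (h (endWires C))
  size-mapOutputs (outputs _) = refl
  size-mapOutputs (g ▹ C)     = cong suc (size-mapOutputs C)

-- From collisions to families: F(i) = (0ⁿ, C(i))

padOutputs : ∀ {n w} → Vec (Fin w) n → Circuit w (n + n)
padOutputs {n} os = const false ▹ outputs (replicate n zero Vec.++ Vec.map suc os)

pad : ∀ {n} → Circuit n n → Circuit n (n + n)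
pad = mapOutputs padOutputs

take-++ : ∀ {A : Set} {m n} (xs : Vec A m) (ys : Vec A n) → Vec.take m (xs Vec.++ ys) ≡ xs
take-++ []       ys = refl
take-++ (x ∷ xs) ys = cong (x ∷_) (take-++ xs ys)

drop-++ : ∀ {A : Set} {m n} (xs : Vec A m) (ys : Vec A n) → Vec.drop m (xs Vec.++ ys) ≡ ys
drop-++ []       ys = refl
drop-++ (x ∷ xs) ys = drop-++ xs ys

eval-pad : ∀ {n} (C : Circuit n n) ρ → eval (pad C) ρ ≡ replicate n false Vec.++ eval C ρ
eval-pad {n} C ρ
  rewrite eval-mapOutputs padOutputs C ρ
        | map-++ (lookup (false ∷ endEnv C ρ)) (replicate n zero) (Vec.map suc (endWires C))
        | map-replicate (lookup (false ∷ endEnv C ρ)) zero n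
        | sym (map-∘ (lookup (false ∷ endEnv C ρ)) suc (endWires C))
        | eval-end C ρ = refl

evalPair-pad : ∀ {n} (C : Circuit n n) ρ → evalPair (pad C) ρ ≡ (replicate n false , eval C ρ)
evalPair-pad {n} C ρ rewrite eval-pad C ρ =
  cong₂ _,_ (take-++ (replicate n false) (eval C ρ)) (drop-++ (replicate n false) (eval C ρ))

-- All sets of the padded family contain 0ⁿ, so `disjoint` never carries a solution and its image is
-- arbitrary. Sending it to `collide` lets the program drop the second tag bit without looking at
-- it.
unpad : ∀ {n} → EKRCandidate n → CollisionCandidate n
unpad (invalid i)    = preimage i
unpad (repeated i j) = collide i j
unpad (disjoint i j) = collide i j

unpad-correct : ∀ {n} (C : Circuit n n) s → EKRSolution (pad C) s → CollisionSolution C (unpad s)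
unpad-correct C (invalid i) (x , eq) =
  trans (cong proj₂ eq′) (sym (cong proj₁ eq′))
  where eq′ = trans (sym (evalPair-pad C i)) eq
unpad-correct C (repeated i j) (i≢j , same)
  with sub , sup ← subst₂ (λ P Q → SetOf P ≐ SetOf Q) (evalPair-pad C i) (evalPair-pad C j) same =
  i≢j , agree (sub (inj₂ refl)) (sup (inj₂ refl))
  where
  agree : ∀ {A : Set} {z a b : A} → z ≡ a ⊎ b ≡ a → z ≡ b ⊎ a ≡ b → a ≡ b
  agree _           (inj₂ a≡b)  = a≡b
  agree (inj₂ b≡a)  _           = sym b≡a
  -- Neither value is matched with the other one, so both are 0ⁿ.
  agree (inj₁ refl) (inj₁ refl) = refl
unpad-correct C (disjoint i j) disj =
  ⊥-elim (subst₂ (λ P Q → SetOf P ⊥ SetOf Q) (evalPair-pad C i) (evalPair-pad C j) disj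
           (inj₁ refl , inj₁ refl))

-- From families to collisions: C(i) = x ⊻ y, where F(i) = (x, y)

-- The last gate of a block carries its result and the newest wire has number 0, so the results are
-- wires 0, 6, 12, ..., latest block first. The circuit thus outputs the xor in reverse, which is
-- harmless: reversal is injective and fixes 0ⁿ.
xorWires : ∀ l → ∀ {w} → Vec (Fin (l * 6 + w)) l
xorWires zero    = []
xorWires (suc l) = zero ∷ Vec.map (6 ↑ʳ_) (xorWires l)

-- The wires p and q are numbered as before the l blocks of six gates that were already added.
xorBlocks : ∀ l {w m k} → Vec (Fin w) m → Vec (Fin w) m → m + l ≡ k → Circuit (l * 6 + w) k
xorBlocks l []       []       refl = outputs (xorWires l)
xorBlocks l (p ∷ ps) (q ∷ qs) eq   =
  not (l * 6 ↑ʳ p) ▹ not (suc (l * 6 ↑ʳ q)) ▹ and zero (suc zero) ▹ or (suc zero) (suc (suc zero)) ▹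
  not (suc zero) ▹ and zero (suc zero) ▹ xorBlocks (suc l) ps qs (trans (+-suc _ l) eq)

xorOutputs : ∀ {n w} → Vec (Fin w) (n + n) → Circuit w n
xorOutputs {n} os = xorBlocks 0 (Vec.take n os) (Vec.drop n os) (+-identityʳ n)

xorHalves : ∀ {n} → Circuit n (n + n) → Circuit n n
xorHalves = mapOutputs xorOutputs

-- This is (p ∨ q) ∧ (¬p ∨ ¬q), with p ∨ q obtained by De Morgan. Because p and q are used only
-- through their negations, the first two gates of a block are the only ones that refer to wires
-- outside it.
xor-gates : ∀ p q → Bool.not (Bool.not q Bool.∧ Bool.not p) Bool.∧ (Bool.not q Bool.∨ Bool.not p) ≡ p xor q
xor-gates false false = refl
xor-gates false true  = refl
xor-gates true  false = refl
xor-gates true  true  = refl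

xorEnv : ∀ {w} → Fin w → Fin w → BitVec w → BitVec (6 + w)
xorEnv p q ρ = b₅ Bool.∧ b₄ ∷ b₅ ∷ b₄ ∷ b₃ ∷ b₂ ∷ b₁ ∷ ρ
  where
  b₁ = Bool.not (lookup ρ p)
  b₂ = Bool.not (lookup ρ q)
  b₃ = b₂ Bool.∧ b₁
  b₄ = b₂ Bool.∨ b₁
  b₅ = Bool.not b₃

-- Lists avoid the length equations that reversing vectors would bring in. The accumulator of `ʳ++`
-- holds the results of the l blocks already present.
eval-xorBlocks : ∀ l {w m k} (ps qs : Vec (Fin w) m) (eq : m + l ≡ k) ρ →
  toList (eval (xorBlocks l ps qs eq) ρ) ≡
  toList (Vec.zipWith _xor_ (Vec.map (lookup ρ ∘ (l * 6 ↑ʳ_)) ps) (Vec.map (lookup ρ ∘ (l * 6 ↑ʳ_)) qs))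
    ʳ++ toList (Vec.map (lookup ρ) (xorWires l))
eval-xorBlocks l []       []       refl ρ = refl
eval-xorBlocks l (p ∷ ps) (q ∷ qs) eq   ρ
  rewrite eval-xorBlocks (suc l) ps qs (trans (+-suc _ l) eq) (xorEnv (l * 6 ↑ʳ p) (l * 6 ↑ʳ q) ρ)
        | sym (map-∘ (lookup (xorEnv (l * 6 ↑ʳ p) (l * 6 ↑ʳ q) ρ)) (6 ↑ʳ_) (xorWires l))
        | xor-gates (lookup ρ (l * 6 ↑ʳ p)) (lookup ρ (l * 6 ↑ʳ q)) = refl

_⊻_ : ∀ {n} → BitVec n → BitVec n → BitVec n
_⊻_ = Vec.zipWith _xor_

evalPair-end : ∀ {n} (F : Circuit n (n + n)) ρ → evalPair F ρ ≡
  (Vec.map (lookup (endEnv F ρ)) (Vec.take n (endWires F)) ,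
   Vec.map (lookup (endEnv F ρ)) (Vec.drop n (endWires F)))
evalPair-end {n} F ρ rewrite eval-end F ρ =
  cong₂ _,_ (take-map (lookup (endEnv F ρ)) n (endWires F)) (drop-map (lookup (endEnv F ρ)) n (endWires F))

eval-xorHalves : ∀ {n} (F : Circuit n (n + n)) ρ →
  toList (eval (xorHalves F) ρ) ≡ toList (proj₁ (evalPair F ρ) ⊻ proj₂ (evalPair F ρ)) ʳ++ []
eval-xorHalves {n} F ρ =
  trans (cong toList (eval-mapOutputs (xorOutputs {n}) F ρ))
    (trans (eval-xorBlocks 0 (Vec.take n (endWires F)) (Vec.drop n (endWires F)) (+-identityʳ n) (endEnv F ρ))
      (cong (λ P → toList (proj₁ P ⊻ proj₂ P) ʳ++ []) (sym (evalPair-end F ρ))))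

toList-injective′ : ∀ {n} {xs ys : BitVec n} → toList xs ≡ toList ys → xs ≡ ys
toList-injective′ = prefixFree⇒injective bits-prefixFree

ʳ++[]-injective : ∀ {A : Set} {xs ys : List A} → xs ʳ++ [] ≡ ys ʳ++ [] → xs ≡ ys
ʳ++[]-injective {xs = xs} {ys} eq =
  trans (sym (++-identityʳ xs)) (trans (sym (ʳ++-ʳ++ xs)) (trans (cong (_ʳ++ []) eq)
    (trans (ʳ++-ʳ++ ys) (++-identityʳ ys))))

eval-xorHalves-injective : ∀ {n} (F : Circuit n (n + n)) i j →
  eval (xorHalves F) i ≡ eval (xorHalves F) j →
  proj₁ (evalPair F i) ⊻ proj₂ (evalPair F i) ≡ proj₁ (evalPair F j) ⊻ proj₂ (evalPair F j)
eval-xorHalves-injective F i j eq =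
  toList-injective′ (ʳ++[]-injective
    (trans (sym (eval-xorHalves F i)) (trans (cong toList eq) (eval-xorHalves F j))))

ʳ++-replicate : ∀ n {ys : String} → toList (replicate n false) ʳ++ ys ≡ toList (replicate n false) ++ ys
ʳ++-replicate zero    = refl
ʳ++-replicate (suc n) {ys} rewrite ʳ++-replicate n {false ∷ ys} = shift n
  where
  shift : ∀ n → toList (replicate n false) ++ false ∷ ys ≡ false ∷ toList (replicate n false) ++ ys
  shift zero    = refl
  shift (suc n) = cong (false ∷_) (shift n)

⊻≡0⇒≡ : ∀ {n} (x y : BitVec n) → x ⊻ y ≡ replicate n false → x ≡ y
⊻≡0⇒≡ []          []          _  = refl
⊻≡0⇒≡ (false ∷ x) (false ∷ y) eq = cong (false ∷_) (⊻≡0⇒≡ x y (cong Vec.tail eq))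
⊻≡0⇒≡ (true ∷ x)  (true ∷ y)  eq = cong (true ∷_) (⊻≡0⇒≡ x y (cong Vec.tail eq))
⊻≡0⇒≡ (false ∷ x) (true ∷ y)  eq with () ← cong Vec.head eq
⊻≡0⇒≡ (true ∷ x)  (false ∷ y) eq with () ← cong Vec.head eq

⊻-cancelˡ : ∀ {n} (x y z : BitVec n) → x ⊻ y ≡ x ⊻ z → y ≡ z
⊻-cancelˡ []      []      []      _  = refl
⊻-cancelˡ (a ∷ x) (b ∷ y) (c ∷ z) eq =
  cong₂ _∷_ (bit a b c (cong Vec.head eq)) (⊻-cancelˡ x y z (cong Vec.tail eq))
  where
  bit : ∀ a b c → a xor b ≡ a xor c → b ≡ c
  bit false _     _     eq = eq
  bit true  false false _  = refl
  bit true  true  true  _  = refl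

⊻-comm : ∀ {n} (x y : BitVec n) → x ⊻ y ≡ y ⊻ x
⊻-comm = zipWith-comm xor-comm

-- A stack serves as a flag: one mark is pushed per differing position and only emptiness is tested,
-- so a program never has to update a bit.
mismatches : ∀ {n} → BitVec n → BitVec n → String → String
mismatches []      []      e = e
mismatches (a ∷ x) (b ∷ y) e = mismatches x y (if a xor b then true ∷ e else e)

mismatches-[] : ∀ {n} (x y : BitVec n) e → mismatches x y e ≡ [] → x ≡ y × e ≡ []
mismatches-[] []          []          e eq = refl , eq
mismatches-[] (false ∷ x) (false ∷ y) e eq with refl , e≡ ← mismatches-[] x y e eq = refl , e≡
mismatches-[] (true ∷ x)  (true ∷ y)  e eq with refl , e≡ ← mismatches-[] x y e eq = refl , e≡
mismatches-[] (false ∷ x) (true ∷ y)  e eq with _ , () ← mismatches-[] x y (true ∷ e) eq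
mismatches-[] (true ∷ x)  (false ∷ y) e eq with _ , () ← mismatches-[] x y (true ∷ e) eq

mismatches-refl : ∀ {n} (x : BitVec n) e → mismatches x x e ≡ e
mismatches-refl []          e = refl
mismatches-refl (false ∷ x) e = mismatches-refl x e
mismatches-refl (true ∷ x)  e = mismatches-refl x e

-- As the two sets are equal or disjoint, it is enough to know whether x lies in {x′, y′}. The
-- arguments are the mismatches of x with x′ and of x with y′.
verdict : ∀ {n} → String → String → BitVec n → BitVec n → EKRCandidate n
verdict []      _       = repeated
verdict (_ ∷ _) []      = repeated
verdict (_ ∷ _) (_ ∷ _) = disjoint

unxor : ∀ {n} → Circuit n (n + n) → CollisionCandidate n → EKRCandidate n
unxor F (preimage i)  = invalid i
unxor F (collide i j) =
  let x , y = evalPair F i ; x′ , y′ = evalPair F j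
  in verdict (mismatches x x′ []) (mismatches x y′ []) i j

unxor-correct : ∀ {n} (F : Circuit n (n + n)) s →
                CollisionSolution (xorHalves F) s → EKRSolution F (unxor F s)
unxor-correct {n} F (preimage i) eq = proj₂ (evalPair F i) , cong (_, proj₂ (evalPair F i))
  (⊻≡0⇒≡ _ _ (toList-injective′ (ʳ++[]-injective
    (trans (sym (eval-xorHalves F i)) (trans (cong toList eq)
      (sym (trans (ʳ++-replicate n) (++-identityʳ _))))))))
unxor-correct F (collide i j) (i≢j , eq) =
  decide (evalPair F i) (evalPair F j) refl refl (eval-xorHalves-injective F i j eq)
  where
  -- Generalising over the two pairs allows equations between their components to be matched with
  -- `refl`.
  decide : ∀ P Q → evalPair F i ≡ P → evalPair F j ≡ Q → proj₁ P ⊻ proj₂ P ≡ proj₁ Q ⊻ proj₂ Q →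
           EKRSolution F (verdict (mismatches (proj₁ P) (proj₁ Q) []) (mismatches (proj₁ P) (proj₂ Q) []) i j)
  decide (x , y) (x′ , y′) eqᵢ eqⱼ eq
    with mismatches x x′ [] in e | mismatches x y′ [] in e′
  ... | [] | _
      with refl , _ ← mismatches-[] x x′ [] e
      with refl ← ⊻-cancelˡ x y y′ eq =
    i≢j , subst₂ (λ P Q → SetOf P ≐ SetOf Q) (sym eqᵢ) (sym eqⱼ) (id , id)
  ... | _ ∷ _ | []
      with refl , _ ← mismatches-[] x y′ [] e′
      with refl ← ⊻-cancelˡ x y x′ (trans eq (⊻-comm x′ x)) =
    i≢j , subst₂ (λ P Q → SetOf P ≐ SetOf Q) (sym eqᵢ) (sym eqⱼ) (swap , swap)
  ... | _ ∷ _ | _ ∷ _ = subst₂ (λ P Q → SetOf P ⊥ SetOf Q) (sym eqᵢ) (sym eqⱼ) apart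
    where
    x≢x′ : x ≢ x′
    x≢x′ refl with () ← trans (sym e) (mismatches-refl x [])
    x≢y′ : x ≢ y′
    x≢y′ refl with () ← trans (sym e′) (mismatches-refl x [])
    -- If y is the common element, cancelling it makes x equal to the other element of the second
    -- set.
    apart : SetOf (x , y) ⊥ SetOf (x′ , y′)
    apart (inj₁ refl , inj₁ refl) = x≢x′ refl
    apart (inj₁ refl , inj₂ refl) = x≢y′ refl
    apart (inj₂ refl , inj₁ refl) = x≢y′ (⊻-cancelˡ y x y′ (trans (⊻-comm y x) eq))
    apart (inj₂ refl , inj₂ refl) = x≢x′ (⊻-cancelˡ y x x′ (trans (⊻-comm y x) (trans eq (⊻-comm x′ y))))

-- Sizes of the constructed circuits

size-xorBlocks : ∀ l {w m k} (ps qs : Vec (Fin w) m) (eq : m + l ≡ k) → size (xorBlocks l ps qs eq) ≡ m * 6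
size-xorBlocks l []       []       refl = refl
size-xorBlocks l (p ∷ ps) (q ∷ qs) eq   = cong (6 +_) (size-xorBlocks (suc l) ps qs _)

padBounded : ∀ {p} → BoundedCircuit (λ n → n) p → BoundedCircuit (λ n → n + n) (p +ₚ (1 ∷ []))
padBounded {p} (bounded n C size≤) = bounded n (pad C) (begin
  size (pad C)                               ≡⟨ size-mapOutputs padOutputs C ⟩
  size C + 1                                 ≤⟨ +-monoˡ-≤ 1 size≤ ⟩
  evalPoly p n + 1                           ≡⟨ cong (evalPoly p n +_) (eval-poly (const 1) n) ⟨
  evalPoly p n + evalPoly (1 ∷ []) n         ≡⟨ eval-+ₚ p (1 ∷ []) n ⟨
  evalPoly (p +ₚ (1 ∷ [])) n                 ∎)
  where open ≤-Reasoning

xorBounded : ∀ {p} → BoundedCircuit (λ n → n + n) p → BoundedCircuit (λ n → n) (p +ₚ (0 ∷ 6 ∷ []))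
xorBounded {p} (bounded n F size≤) = bounded n (xorHalves F) (begin
  size (xorHalves F)                         ≡⟨ size-mapOutputs xorOutputs F ⟩
  size F + size (xorOutputs (endWires F))    ≡⟨ cong (size F +_) (size-xorBlocks 0 _ _ _) ⟩
  size F + n * 6                             ≤⟨ +-monoˡ-≤ (n * 6) size≤ ⟩
  evalPoly p n + n * 6                       ≡⟨ cong (λ c → evalPoly p n + n * (6 + c)) (*-zeroʳ n) ⟨
  evalPoly p n + evalPoly (0 ∷ 6 ∷ []) n     ≡⟨ eval-+ₚ p (0 ∷ 6 ∷ []) n ⟨
  evalPoly (p +ₚ (0 ∷ 6 ∷ [])) n             ∎)
  where open ≤-Reasoning

-- Copying between stacks

isTrue : Symbol → Bool
isTrue = fromMaybe false

infixl 4 _▸_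

_▸_ : ∀ {k} {p : Prog k} {s t s′ s″} → p ⊢ s ⇓[ t ] s′ → s′ ≡ s″ → p ⊢ s ⇓[ t ] s″
d ▸ refl = d

-- Used with `_▸_` to rewrite one stack of a final state while the others agree by computation.
at : ∀ {k} (i : Fin k) {s : Vec String k} {v} → lookup s i ≡ v → s ≡ updateAt s i (λ _ → v)
at i {s} eq = sym (updateAt-id-local i s (sym eq))

case-on : ∀ {k i s s′ t} {f : Symbol → Prog k} {a} → List.head (lookup s i) ≡ a → f a ⊢ s ⇓[ t ] s′ →
          case i f ⊢ s ⇓[ suc t ] s′
case-on refl d = case d

moveTop : ∀ {k} → Fin k → Fin k → Prog k
moveTop i j = case i λ { (just b) → pop i ⨾ push j b ; nothing → skip }

transfer : ∀ {k} → Fin k → Fin k → Prog k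
transfer i j = while i is-just (moveTop i j)

-- The terminator of the unary number is consumed but not copied, so the copy can still be raised.
copyOnes : ∀ {k} → Fin k → Fin k → Prog k
copyOnes i j = while i isTrue (pop i ⨾ push j true) ⨾ pop i

copyUnary : ∀ {k} → Fin k → Fin k → Prog k
copyUnary i j = copyOnes i j ⨾ push j false

emit : ∀ {k} → Fin k → String → Prog k
emit i []      = skip
emit i (b ∷ w) = push i b ⨾ emit i w

emitTime : String → ℕ
emitTime []      = 1
emitTime (_ ∷ w) = 2 + emitTime w

emit-⇓ : ∀ {k} (i : Fin k) w {s} → emit i w ⊢ s ⇓[ emitTime w ] updateAt s i (w ʳ++_)
emit-⇓ i []      {s} = skip ▸ sym (updateAt-id-local i s refl)
emit-⇓ i (b ∷ w) {s} = push ⨾ emit-⇓ i w ▸ updateAt-updateAt i s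

private
  set-step : ∀ {k} {i j : Fin k} → i ≢ j → ∀ (s : Vec String k) v (f g : String → String) →
    updateAt (updateAt (updateAt (updateAt s i (drop 1)) j f) i (λ _ → v)) j g ≡
    updateAt (updateAt s i (λ _ → v)) j (g ∘ f)
  set-step {i = i} {j} i≢j s v f g
    rewrite updateAt-commutes i j {λ _ → v} {f} i≢j (updateAt s i (drop 1))
          | updateAt-updateAt i {λ _ → v} {drop 1} s
          = updateAt-updateAt j (updateAt s i (λ _ → v))

  set-done : ∀ {k} {i j : Fin k} (s : Vec String k) v → lookup s i ≡ v →
             s ≡ updateAt (updateAt s i (λ _ → v)) j id
  set-done {i = i} {j} s v eq =
    trans (at i eq) (sym (updateAt-id-local j (updateAt s i _) refl))

  rest : ∀ {k} {i j : Fin k} → i ≢ j → ∀ (s : Vec String k) {f b v} → lookup s i ≡ b ∷ v →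
         lookup (updateAt (updateAt s i (drop 1)) j f) i ≡ v
  rest {i = i} {j} i≢j s eq =
    trans (lookup∘updateAt′ i j i≢j (updateAt s i _)) (trans (lookup∘updateAt i s) (cong (drop 1) eq))

transfer-⇓ : ∀ {k} {i j : Fin k} → i ≢ j → ∀ w {s} → lookup s i ≡ w →
         transfer i j ⊢ s ⇓[ rounds (length w) 4 ] updateAt (updateAt s i (λ _ → [])) j (w ʳ++_)
transfer-⇓ i≢j []      {s} eq = stop (cong (is-just ∘ List.head) eq) ▸ set-done s [] eq
transfer-⇓ {i = i} {j} i≢j (b ∷ w) {s} eq =
  loop (cong (is-just ∘ List.head) eq) (case-on (cong List.head eq) (pop ⨾ push))
       (transfer-⇓ i≢j w (rest i≢j s eq))
  ▸ set-step i≢j s [] (b ∷_) (w ʳ++_)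

ones : ℕ → String → String
ones zero    w = w
ones (suc n) w = ones n (true ∷ w)

unary-ʳ++ : ∀ n {w} → unary n ʳ++ w ≡ false ∷ ones n w
unary-ʳ++ zero    = refl
unary-ʳ++ (suc n) = unary-ʳ++ n

ones-+ : ∀ m n {w} → ones m (ones n w) ≡ ones (n + m) w
ones-+ m zero    = refl
ones-+ m (suc n) = ones-+ m n

ones-∷ : ∀ n {w} → ones n (true ∷ w) ≡ true ∷ ones n w
ones-∷ zero    = refl
ones-∷ (suc n) = ones-∷ n

ones-ʳ++ : ∀ n {v w} → ones n v ʳ++ w ≡ v ʳ++ ones n w
ones-ʳ++ zero            = refl
ones-ʳ++ (suc n) {v} {w} = trans (ones-ʳ++ n) (cong (v ʳ++_) (sym (ones-∷ n)))

ones-replicate : ∀ n → ones n [] ≡ List.replicate n true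
ones-replicate zero    = refl
ones-replicate (suc n) = trans (ones-∷ n) (cong (true ∷_) (ones-replicate n))

copyOnes-⇓ : ∀ {k} {i j : Fin k} → i ≢ j → ∀ n {r s} → lookup s i ≡ unary n ++ r →
  copyOnes i j ⊢ s ⇓[ rounds n 3 + 1 ] updateAt (updateAt s i (λ _ → r)) j (ones n)
copyOnes-⇓ {i = i} {j} i≢j n {r} {s} eq = loops n eq ⨾ pop ▸ finish
  where
  loops : ∀ n {s} → lookup s i ≡ unary n ++ r →
    while i isTrue (pop i ⨾ push j true) ⊢ s ⇓[ rounds n 3 ]
    updateAt (updateAt s i (λ _ → false ∷ r)) j (ones n)
  loops zero    {s} eq = stop (cong (isTrue ∘ List.head) eq) ▸ set-done s _ eq
  loops (suc n) {s} eq =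
    loop (cong (isTrue ∘ List.head) eq) (pop ⨾ push) (loops n (rest i≢j s eq))
    ▸ set-step i≢j s _ (true ∷_) (ones n)
  finish : updateAt (updateAt (updateAt s i (λ _ → false ∷ r)) j (ones n)) i (drop 1) ≡
           updateAt (updateAt s i (λ _ → r)) j (ones n)
  finish rewrite updateAt-commutes i j {drop 1} {ones n} i≢j (updateAt s i (λ _ → false ∷ r)) =
    cong (λ v → updateAt v j (ones n)) (updateAt-updateAt i s)

copyUnary-⇓ : ∀ {k} {i j : Fin k} → i ≢ j → ∀ n {r s} → lookup s i ≡ unary n ++ r →
  copyUnary i j ⊢ s ⇓[ rounds n 3 + 1 + 2 ] updateAt (updateAt s i (λ _ → r)) j (unary n ʳ++_)
copyUnary-⇓ {j = j} i≢j n {r} {s} eq = copyOnes-⇓ i≢j n eq ⨾ push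
  ▸ trans (updateAt-updateAt j _) (updateAt-cong j (λ w → sym (unary-ʳ++ n)) _)

-- Stack i starts empty, so by `⇓-length` it ends no longer than the running time of p, and this
-- bounds the rounds of the transfer.
⇓-then-transfer : ∀ {k} {i j : Fin k} {p : Prog k} {s s′ e n} → i ≢ j → lookup s i ≡ [] →
  p ⊢ s ⇓[ ⟦ e ⟧ n ] s′ →
  p ⨾ transfer i j ⊢ s ⇓[ ⟦ e ⊕ loop e (const 4) ⟧ n ]
    updateAt (updateAt s′ i (λ _ → [])) j (lookup s′ i ʳ++_)
⇓-then-transfer {i = i} {s = s} {e = e} {n} i≢j eq d =
  d ⨾ weaken (rounds-mono length≤ ≤-refl) (transfer-⇓ i≢j _ refl)
  where
  length≤ = subst (λ w → _ ≤ length w + ⟦ e ⟧ n) eq (⇓-length d i)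

-- Copying a circuit up to its outputs; stack 0 is the input and stack 2 the reversed output

moveBit : ∀ {k} → Prog (3 + k)
moveBit = moveTop 0F 2F

copyWire : ∀ {k} → Prog (3 + k)
copyWire = copyUnary 0F 2F

-- The blank branches here and in `gateProg` are fillers: gate codes are self-delimiting, so a
-- well-formed code is never read past its end.
copyGate : ∀ {k} → Prog (3 + k)
copyGate = case 0F λ
  { nothing      → skip
  ; (just false) → moveBit ⨾ case 0F λ
      { nothing      → skip
      ; (just false) → moveBit ⨾ moveBit
      ; (just true)  → moveBit ⨾ copyWire }
  ; (just true)  → moveBit ⨾ moveBit ⨾ copyWire ⨾ copyWire }

copyGates : ∀ {k} → Prog (3 + k)
copyGates = while 0F isTrue (moveBit ⨾ copyGate)

-- 14 is the time for the three bits of a `const` gate: three moves of 4 steps and two tests. The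
-- other gates take at most 10 apart from their wires.
wireB gateB : Bound
wireB = loop var (const 3) ⊕ const 3
gateB = const 14 ⊕ wireB ⊕ wireB

toℕ≤ : ∀ {w n} (i : Fin w) → w ≤ n → toℕ i ≤ n
toℕ≤ i w≤n = ≤-trans (<⇒≤ (toℕ<n i)) w≤n

module _ {n : ℕ} where

  copyWire-⇓ : ∀ {k} {i j : Fin k} → i ≢ j → ∀ {w} (v : Fin w) {r s} → w ≤ n →
    lookup s i ≡ wireCode v ++ r →
    copyUnary i j ⊢ s ⇓[ ⟦ wireB ⟧ n ] updateAt (updateAt s i (λ _ → r)) j (wireCode v ʳ++_)
  copyWire-⇓ i≢j v w≤n eq =
    weaken (≤-trans (≤-reflexive (+-assoc _ 1 2)) (+-monoˡ-≤ 3 (rounds-mono (toℕ≤ v w≤n) ≤-refl)))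
           (copyUnary-⇓ i≢j (toℕ v) eq)

  copyGate-⇓ : ∀ {k w} (g : Gate w) {r o R} {s : Vec String k} → w ≤ n →
    copyGate ⊢ (gateCode g ++ r) ∷ o ∷ R ∷ s ⇓[ ⟦ gateB ⟧ n ] r ∷ o ∷ (gateCode g ʳ++ R) ∷ s
  copyGate-⇓ (const b) w≤n =
    weaken (m≤m+n 14 _) (case (case (pop ⨾ push) ⨾ case (case (pop ⨾ push) ⨾ case (pop ⨾ push))))
  copyGate-⇓ (not i) w≤n =
    weaken (+-mono-≤ (m≤m+n 10 4) (m≤m+n (⟦ wireB ⟧ n) _))
      (case (case (pop ⨾ push) ⨾ case (case (pop ⨾ push) ⨾ copyWire-⇓ (λ ()) i w≤n refl)))
  copyGate-⇓ (and i j) {r} {o} {R} w≤n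
    rewrite ++-assoc (wireCode i) (wireCode j) r | ++-ʳ++ (wireCode i) {wireCode j} {false ∷ true ∷ R} =
    weaken (+-monoˡ-≤ (⟦ wireB ⊕ wireB ⟧ n) (m≤m+n 9 5))
      (case (case (pop ⨾ push) ⨾ case (pop ⨾ push) ⨾ copyWire-⇓ (λ ()) i w≤n refl ⨾ copyWire-⇓ (λ ()) j w≤n refl))
  copyGate-⇓ (or i j)  {r} {o} {R} w≤n
    rewrite ++-assoc (wireCode i) (wireCode j) r | ++-ʳ++ (wireCode i) {wireCode j} {true ∷ true ∷ R} =
    weaken (+-monoˡ-≤ (⟦ wireB ⊕ wireB ⟧ n) (m≤m+n 9 5))
      (case (case (pop ⨾ push) ⨾ case (pop ⨾ push) ⨾ copyWire-⇓ (λ ()) i w≤n refl ⨾ copyWire-⇓ (λ ()) j w≤n refl))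

  copyGates-⇓ : ∀ {k w m} (C : Circuit w m) {o R} {s : Vec String k} → w + size C ≤ n →
    copyGates ⊢ circuitCode C ∷ o ∷ R ∷ s ⇓[ rounds (size C) (4 + ⟦ gateB ⟧ n) ]
                (false ∷ wiresCode (endWires C)) ∷ o ∷ (gatesCode C ʳ++ R) ∷ s
  copyGates-⇓ (outputs os) _ = stop refl
  copyGates-⇓ (g ▹ C) {R = R} w≤n rewrite ++-ʳ++ (gateCode g) {gatesCode C} {true ∷ R} =
    loop refl (case (pop ⨾ push) ⨾ copyGate-⇓ g (≤-trans (m≤m+n _ _) w≤n))
         (copyGates-⇓ C (≤-trans (≤-reflexive (sym (+-suc _ _))) w≤n))

-- Stack 3 receives the number of inputs in unary.
copyHeader : ∀ {k} → Prog (4 + k)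
copyHeader = while 0F isTrue (pop 0F ⨾ push 2F true ⨾ push 3F true) ⨾ pop 0F ⨾ push 2F false

copyHeader-⇓ : ∀ {k} m {r o R} {s : Vec String k} →
  copyHeader ⊢ (unary m ++ r) ∷ o ∷ R ∷ [] ∷ s ⇓[ rounds m 5 + 3 ]
               r ∷ o ∷ (unary m ʳ++ R) ∷ List.replicate m true ∷ s
copyHeader-⇓ m {R = R} rewrite unary-ʳ++ m {R} | sym (ones-replicate m) = loops m ⨾ pop ⨾ push
  where
  loops : ∀ m {k r o R N} {s : Vec String k} →
    while 0F isTrue (pop 0F ⨾ push 2F true ⨾ push 3F true) ⊢ (unary m ++ r) ∷ o ∷ R ∷ N ∷ s
      ⇓[ rounds m 5 ] (false ∷ r) ∷ o ∷ ones m R ∷ ones m N ∷ s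
  loops zero    = stop refl
  loops (suc m) = loop refl (pop ⨾ push ⨾ push) (loops m)

copyCircuit : ∀ {k} → Prog (4 + k)
copyCircuit = copyHeader ⨾ copyGates ⨾ pop 0F

copyB : Bound
copyB = (loop var (const 5) ⊕ const 3) ⊕ loop var (const 4 ⊕ gateB) ⊕ const 1

-- Each input and each gate contributes at least one bit to the code. The left side counts all
-- wires, hence bounds wire numbers and loop counts alike.
instance-width : ∀ {out p} (I : BoundedCircuit out p) → let open BoundedCircuit I in
                 n + size circuit ≤ totalLength (boundedCode I ∷ [])
instance-width (bounded m C _) =
  ≤-trans (+-mono-≤ (unary≤ m) (size≤ C))
    (≤-reflexive (trans (sym (length-++ (unary m))) (sym (+-identityʳ _))))
  where
  unary≤ : ∀ m → m ≤ length (unary m)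
  unary≤ zero    = z≤n
  unary≤ (suc m) = s≤s (unary≤ m)
  size≤ : ∀ {w l} (C : Circuit w l) → size C ≤ length (circuitCode C)
  size≤ (outputs _) = z≤n
  size≤ (g ▹ C)     = s≤s (≤-trans (size≤ C) (≤-trans (m≤n+m _ (length (gateCode g)))
                        (≤-reflexive (sym (length-++ (gateCode g))))))

copyCircuit-⇓ : ∀ {k out p} (I : BoundedCircuit out p) {n} {s : Vec String k} →
  let open BoundedCircuit I renaming (n to m) in m + size circuit ≤ n →
  copyCircuit ⊢ boundedCode I ∷ [] ∷ [] ∷ [] ∷ s ⇓[ ⟦ copyB ⟧ n ]
    wiresCode (endWires circuit) ∷ [] ∷ ((unary m ++ gatesCode circuit) ʳ++ []) ∷ List.replicate m true ∷ s
copyCircuit-⇓ (bounded m C _) ≤n rewrite ++-ʳ++ (unary m) {gatesCode C} {[]} =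
  weaken (+-monoˡ-≤ 3 (rounds-mono (m+n≤o⇒m≤o m ≤n) ≤-refl)) (copyHeader-⇓ m)
  ⨾ weaken (rounds-mono (m+n≤o⇒n≤o m ≤n) ≤-refl) (copyGates-⇓ C ≤n)
  ⨾ pop

-- The two instance maps

finish-⇓ : ∀ {k} {p : Prog (3 + k)} {s : Vec String k} {i i′ w s′} e n →
  p ⊢ i ∷ [] ∷ [] ∷ s ⇓[ ⟦ e ⟧ n ] i′ ∷ [] ∷ (w ʳ++ []) ∷ s′ →
  p ⨾ transfer 2F 1F ⊢ i ∷ [] ∷ [] ∷ s ⇓[ ⟦ e ⊕ loop e (const 4) ⟧ n ] i′ ∷ w ∷ [] ∷ s′
finish-⇓ {w = w} e n d = ⇓-then-transfer {e = e} {n} (λ ()) refl d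
  ▸ at 1F (trans (ʳ++-ʳ++ w) (++-identityʳ w))

padProg : Prog 5
padProg = (copyCircuit
  -- The marker of a gate, the code of `const false`, and the marker that ends the gates.
  ⨾ emit 2F (true ∷ false ∷ false ∷ false ∷ false ∷ [])
  -- `unary 0` is a single `false`, a reference to the new wire; stack 4 saves the counter.
  ⨾ while 3F is-just (pop 3F ⨾ push 2F false ⨾ push 4F true)
  ⨾ transfer 4F 3F
  -- The extra `true` shifts an old output past the new gate.
  ⨾ while 3F is-just (pop 3F ⨾ push 2F true ⨾ copyWire))
  ⨾ transfer 2F 1F

padB′ padB : Bound
padB′ = copyB ⊕ const 11 ⊕ loop var (const 5) ⊕ loop var (const 4) ⊕ loop var (const 3 ⊕ wireB)
padB  = padB′ ⊕ loop padB′ (const 4)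

wiresCode-++ : ∀ {w l m} (is : Vec (Fin w) l) (js : Vec (Fin w) m) →
               wiresCode (is Vec.++ js) ≡ wiresCode is ++ wiresCode js
wiresCode-++ []       js = refl
wiresCode-++ (i ∷ is) js = trans (cong (wireCode i ++_) (wiresCode-++ is js)) (sym (++-assoc (wireCode i) _ _))

zeros-⇓ : ∀ m {w i o R S} →
  while 3F is-just (pop 3F ⨾ push 2F false ⨾ push 4F true) ⊢
    i ∷ o ∷ R ∷ List.replicate m true ∷ S ∷ []
    ⇓[ rounds m 5 ] i ∷ o ∷ (wiresCode (replicate m (zero {w})) ʳ++ R) ∷ [] ∷ ones m S ∷ []
zeros-⇓ zero    = stop refl
zeros-⇓ (suc m) = loop refl (pop ⨾ push ⨾ push) (zeros-⇓ m)

shifted-⇓ : ∀ {w m n} (os : Vec (Fin w) m) {o R S} → w ≤ n →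
  while 3F is-just (pop 3F ⨾ push 2F true ⨾ copyWire) ⊢
    wiresCode os ∷ o ∷ R ∷ List.replicate m true ∷ S ∷ []
    ⇓[ rounds m (3 + ⟦ wireB ⟧ n) ] [] ∷ o ∷ (wiresCode (Vec.map suc os) ʳ++ R) ∷ [] ∷ S ∷ []
shifted-⇓ []       _ = stop refl
shifted-⇓ (v ∷ os) {R = R} w≤n rewrite ++-ʳ++ (wireCode v) {wiresCode (Vec.map suc os)} {true ∷ R} =
  loop refl (pop ⨾ push ⨾ copyWire-⇓ (λ ()) v w≤n refl) (shifted-⇓ os w≤n)

endWidth≤ : ∀ {w m n} (C : Circuit w m) → w + size C ≤ n → endWidth C ≤ n
endWidth≤ C = ≤-trans (≤-reflexive (endWidth≡ C))

length-ones : ∀ m → length (ones m []) ≡ m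
length-ones m = trans (cong length (ones-replicate m)) (length-replicate m)

ones-moved : ∀ m → ones m [] ʳ++ [] ≡ List.replicate m true
ones-moved m = trans (ones-ʳ++ m) (ones-replicate m)

padProg-⇓ : ∀ {p} (I : BoundedCircuit (λ n → n) p) → ∃[ s ]
  (padProg ⊢ boundedCode I ∷ [] ∷ [] ∷ [] ∷ [] ∷ [] ⇓[ ⟦ padB ⟧ (totalLength (boundedCode I ∷ [])) ] s
  × lookup s 1F ≡ boundedCode (padBounded I))
padProg-⇓ I@(bounded m C _) = _ , finish-⇓ padB′ n (main ▸ at 2F code) , refl
  where
  n = totalLength (boundedCode I ∷ [])
  ≤n : m + size C ≤ n
  ≤n = instance-width I
  m≤n = m+n≤o⇒m≤o m ≤n
  main = copyCircuit-⇓ I ≤n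
    ⨾ emit-⇓ 2F _
    ⨾ weaken (rounds-mono m≤n ≤-refl) (zeros-⇓ m {endWidth C})
    ⨾ (weaken (rounds-mono (≤-trans (≤-reflexive (length-ones m)) m≤n) ≤-refl) (transfer-⇓ (λ ()) _ refl)
       ▸ at 3F (ones-moved m))
    ⨾ weaken (rounds-mono m≤n ≤-refl) (shifted-⇓ (endWires C) (endWidth≤ C ≤n))
  code : wiresCode (Vec.map suc (endWires C)) ʳ++ (wiresCode (replicate m (zero {endWidth C})) ʳ++
           (false ∷ false ∷ false ∷ false ∷ true ∷ ((unary m ++ gatesCode C) ʳ++ []))) ≡
         (unary m ++ circuitCode (pad C)) ʳ++ []
  code rewrite circuitCode-mapOutputs padOutputs C
             | wiresCode-++ (replicate m (zero {endWidth C})) (Vec.map suc (endWires C)) =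
    sym (trans (cong (_ʳ++ []) (sym (++-assoc (unary m) (gatesCode C) _)))

        (trans (++-ʳ++ (unary m ++ gatesCode C)) (++-ʳ++ (wiresCode (replicate m zero)))))

-- A block has six gates: each element of stack 6, which counts the blocks that precede, raises
-- the index of a wire by six.
addShift : Prog 8
addShift = while 6F is-just (pop 6F ⨾ push 7F true ⨾ emit 2F (List.replicate 6 true)) ⨾ transfer 7F 6F

shiftB : Bound
shiftB = loop var (const 16) ⊕ loop var (const 4)

addShift-⇓ : ∀ {n} l {i o R N P Q} → l ≤ n →
  addShift ⊢ i ∷ o ∷ R ∷ N ∷ P ∷ Q ∷ List.replicate l true ∷ [] ∷ [] ⇓[ ⟦ shiftB ⟧ n ]
             i ∷ o ∷ ones (l * 6) R ∷ N ∷ P ∷ Q ∷ List.replicate l true ∷ [] ∷ []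
addShift-⇓ l l≤n =
  weaken (rounds-mono l≤n ≤-refl) (loops l)
  ⨾ (weaken (rounds-mono (≤-trans (≤-reflexive (length-ones l)) l≤n) ≤-refl) (transfer-⇓ (λ ()) _ refl)
     ▸ at 6F (ones-moved l))
  where
  loops : ∀ l {i o R N P Q T} →
    while 6F is-just (pop 6F ⨾ push 7F true ⨾ emit 2F (List.replicate 6 true)) ⊢
      i ∷ o ∷ R ∷ N ∷ P ∷ Q ∷ List.replicate l true ∷ T ∷ [] ⇓[ rounds l 16 ]
      i ∷ o ∷ ones (l * 6) R ∷ N ∷ P ∷ Q ∷ [] ∷ ones l T ∷ []
  loops zero    = stop refl
  loops (suc l) = loop refl (pop ⨾ push ⨾ emit-⇓ 2F (List.replicate 6 true)) (loops l)

-- A block needs one wire from each half of the outputs, but the code lists the first half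
-- completely before the second. The first half is set aside so that both can be read in step.
storeWires : Prog 8
storeWires = while 3F is-just (pop 3F ⨾ copyUnary 0F 4F ⨾ push 6F true)

storeWires-⇓ : ∀ {n w m} (os : Vec (Fin w) m) {r o R P Q S T} → w ≤ n →
  storeWires ⊢ (wiresCode os ++ r) ∷ o ∷ R ∷ List.replicate m true ∷ P ∷ Q ∷ S ∷ T ∷ []
    ⇓[ rounds m (1 + (⟦ wireB ⟧ n + 2)) ] r ∷ o ∷ R ∷ [] ∷ (wiresCode os ʳ++ P) ∷ Q ∷ ones m S ∷ T ∷ []
storeWires-⇓ []       _ = stop refl
storeWires-⇓ (v ∷ os) {r} {P = P} w≤n
  rewrite ++-assoc (wireCode v) (wiresCode os) r | ++-ʳ++ (wireCode v) {wiresCode os} {P} =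
  loop refl (pop ⨾ copyWire-⇓ (λ ()) v w≤n refl ⨾ push) (storeWires-⇓ os w≤n)

-- These gates refer only to wires of their own block, so their codes are the same in all blocks.
xorTail : String
xorTail =
  true ∷ gateCode {2} (and zero (suc zero)) ++
  true ∷ gateCode {3} (or (suc zero) (suc (suc zero))) ++
  true ∷ gateCode {4} (not (suc zero)) ++
  true ∷ gateCode {5} (and zero (suc zero))

writeBlocks : Prog 8
writeBlocks = while 3F is-just
  ( pop 3F
  -- The marker of a gate and the tag of `not`.
  ⨾ emit 2F (true ∷ false ∷ true ∷ [])
  ⨾ copyOnes 5F 2F ⨾ addShift
  -- The terminator held back by `copyOnes`, then marker and tag of the second `not`; the last
  -- `true` accounts for the gate just added, which shifts q by one.
  ⨾ emit 2F (false ∷ true ∷ false ∷ true ∷ true ∷ [])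
  ⨾ copyOnes 0F 2F ⨾ addShift
  ⨾ emit 2F (false ∷ xorTail)
  ⨾ push 6F true )

onesB blockB : Bound
onesB  = loop var (const 3) ⊕ const 1
blockB = const 8 ⊕ onesB ⊕ shiftB ⊕ const 11 ⊕ onesB ⊕ shiftB ⊕ const (emitTime (false ∷ xorTail) + 2)

writeBlocks-⇓ : ∀ {n} l {w m k} (ps qs : Vec (Fin w) m) (eq : m + l ≡ k) {o R P} →
  w ≤ n → m + l ≤ n →
  writeBlocks ⊢ wiresCode qs ∷ o ∷ R ∷ List.replicate m true ∷ P ∷ wiresCode ps ∷ List.replicate l true ∷ [] ∷ []
    ⇓[ rounds m (⟦ blockB ⟧ n) ]
    [] ∷ o ∷ (gatesCode (xorBlocks l ps qs eq) ʳ++ R) ∷ [] ∷ P ∷ [] ∷ ones m (List.replicate l true) ∷ [] ∷ []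
writeBlocks-⇓ l [] [] refl _ _ = stop refl
writeBlocks-⇓ {n} l {m = suc m} (p ∷ ps) (q ∷ qs) eq {R = R} w≤n l+m≤n =
  loop refl
    ( pop
    ⨾ emit-⇓ 2F (true ∷ false ∷ true ∷ [])
    ⨾ copyOnes-≤ (λ ()) p refl
    ⨾ addShift-⇓ l l≤n
    ⨾ emit-⇓ 2F (false ∷ true ∷ false ∷ true ∷ true ∷ [])
    ⨾ copyOnes-≤ (λ ()) q refl
    ⨾ addShift-⇓ l l≤n
    ⨾ emit-⇓ 2F (false ∷ xorTail)
    ⨾ push )
    (writeBlocks-⇓ (suc l) ps qs (trans (+-suc m l) eq) w≤n (≤-trans (≤-reflexive (+-suc m l)) l+m≤n))
  ▸ at 2F code
  where
  l≤n : l ≤ n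
  l≤n = m+n≤o⇒n≤o (suc m) l+m≤n
  copyOnes-≤ : ∀ {i} → i ≢ 2F → ∀ (v : Fin _) {r s} → lookup s i ≡ wireCode v ++ r →
    copyOnes i 2F ⊢ s ⇓[ ⟦ onesB ⟧ n ] _
  copyOnes-≤ i≢2 v eq = weaken (+-monoˡ-≤ 1 (rounds-mono (toℕ≤ v w≤n) ≤-refl)) (copyOnes-⇓ i≢2 (toℕ v) eq)
  shifted : ∀ (v : Fin _) {w} → wireCode (l * 6 ↑ʳ v) ʳ++ w ≡ false ∷ ones (l * 6) (ones (toℕ v) w)
  shifted v = trans (unary-ʳ++ (toℕ (l * 6 ↑ʳ v)))
    (cong (false ∷_) (trans (cong (λ x → ones x _) (trans (toℕ-↑ʳ (l * 6) v) (+-comm (l * 6) (toℕ v))))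
                            (sym (ones-+ (l * 6) (toℕ v)))))
  later : String
  later = xorTail ++ gatesCode (xorBlocks (suc l) ps qs (trans (+-suc m l) eq))
  code : later ʳ++ (false ∷ ones (l * 6) (ones (toℕ q) (true ∷ true ∷ false ∷ true ∷
           (false ∷ ones (l * 6) (ones (toℕ p) (true ∷ false ∷ true ∷ R)))))) ≡
         gatesCode (xorBlocks l (p ∷ ps) (q ∷ qs) eq) ʳ++ R
  code = sym (trans (++-ʳ++ (wireCode (l * 6 ↑ʳ p)))
    (trans (cong (λ v → (true ∷ false ∷ true ∷ true ∷ wireCode (l * 6 ↑ʳ q) ++ later) ʳ++ v) (shifted p))
    (trans (++-ʳ++ (wireCode (l * 6 ↑ʳ q)))
           (cong (later ʳ++_) (shifted q)))))

-- Codes depend only on the numbers of the wires. Passing to numbers allows an offset of 6 per block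
-- without tracking the widths of the circuits in which these are wires.
natsCode : ∀ {m} → Vec ℕ m → String
natsCode []       = []
natsCode (a ∷ as) = unary a ++ natsCode as

wiresCode-nats : ∀ {w m} (os : Vec (Fin w) m) → wiresCode os ≡ natsCode (Vec.map toℕ os)
wiresCode-nats []       = refl
wiresCode-nats (v ∷ os) = cong (wireCode v ++_) (wiresCode-nats os)

endWires-xorBlocks : ∀ l {w m k} (ps qs : Vec (Fin w) m) (eq : m + l ≡ k) →
  wiresCode (endWires (xorBlocks l ps qs eq)) ≡ wiresCode (xorWires k {w})
endWires-xorBlocks l []       []       refl = refl
endWires-xorBlocks l (p ∷ ps) (q ∷ qs) eq   = endWires-xorBlocks (suc l) ps qs _

writeXorWires : Prog 8
writeXorWires = while 3F is-just (pop 3F ⨾ addShift ⨾ emit 2F (false ∷ []) ⨾ push 6F true)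

writeXorWires-⇓ : ∀ {n} l m {w i o R P Q} → m + l ≤ n →
  writeXorWires ⊢ i ∷ o ∷ R ∷ List.replicate m true ∷ P ∷ Q ∷ List.replicate l true ∷ [] ∷ []
    ⇓[ rounds m (⟦ const 1 ⊕ shiftB ⊕ const 5 ⟧ n) ]
    i ∷ o ∷ (natsCode (Vec.map ((l * 6 +_) ∘ toℕ) (xorWires m {w})) ʳ++ R) ∷ [] ∷ P ∷ Q ∷
    ones m (List.replicate l true) ∷ [] ∷ []
writeXorWires-⇓ l zero _ = stop refl
writeXorWires-⇓ l (suc m) {w} {R = R} m+l≤n =
  loop refl
    (pop ⨾ addShift-⇓ l (m+n≤o⇒n≤o (suc m) m+l≤n) ⨾ emit-⇓ 2F (false ∷ []) ⨾ push)
    (writeXorWires-⇓ (suc l) m {w} (≤-trans (≤-reflexive (+-suc m l)) m+l≤n))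
  ▸ at 2F code
  where
  shift : ∀ i → 6 + l * 6 + i ≡ l * 6 + (6 + i)
  shift i = trans (cong (_+ i) (+-comm 6 (l * 6))) (+-assoc (l * 6) 6 i)
  code : natsCode (Vec.map ((suc l * 6 +_) ∘ toℕ) (xorWires m {w})) ʳ++ (false ∷ ones (l * 6) R) ≡
         natsCode (Vec.map ((l * 6 +_) ∘ toℕ) (xorWires (suc m) {w})) ʳ++ R
  code rewrite sym (map-∘ ((l * 6 +_) ∘ toℕ) (6 ↑ʳ_) (xorWires m {w}))
             | ++-ʳ++ (unary (l * 6 + 0)) {natsCode (Vec.map ((l * 6 +_) ∘ toℕ ∘ (6 ↑ʳ_)) (xorWires m {w}))} {R}
             | +-identityʳ (l * 6)
             | unary-ʳ++ (l * 6) {R} =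
    cong (λ v → natsCode v ʳ++ (false ∷ ones (l * 6) R)) (map-cong (shift ∘ toℕ) (xorWires m))

xorProg : Prog 8
xorProg = ((copyCircuit ⨾ storeWires) ⨾ transfer 4F 5F)
  -- Each transfer from stack 6 restores the counter n and at the same time resets the number of
  -- preceding blocks to zero.
  ⨾ transfer 6F 3F ⨾ writeBlocks ⨾ emit 2F (false ∷ []) ⨾ transfer 6F 3F ⨾ writeXorWires

xorStart xorB′ xorB : Bound
xorStart = copyB ⊕ loop var (const 1 ⊕ wireB ⊕ const 2)
xorB′ = (xorStart ⊕ loop xorStart (const 4)) ⊕ loop var (const 4) ⊕ loop var blockB ⊕ const 3 ⊕
        loop var (const 4) ⊕ loop var (const 1 ⊕ shiftB ⊕ const 5)
xorB  = xorB′ ⊕ loop xorB′ (const 4)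

xorProg-⇓ : ∀ {p} (I : BoundedCircuit (λ n → n + n) p) → ∃[ s ]
  (xorProg ⨾ transfer 2F 1F ⊢ boundedCode I ∷ replicate 7 [] ⇓[ ⟦ xorB ⟧ (totalLength (boundedCode I ∷ [])) ] s
  × lookup s 1F ≡ boundedCode (xorBounded I))
xorProg-⇓ I@(bounded m F _) = _ , finish-⇓ xorB′ n (main ▸ at 2F code) , refl
  where
  n = totalLength (boundedCode I ∷ [])
  ≤n : m + size F ≤ n
  ≤n = instance-width I
  m≤n = m+n≤o⇒m≤o m ≤n
  m+0≤n : m + 0 ≤ n
  m+0≤n = ≤-trans (≤-reflexive (+-identityʳ m)) m≤n
  os = endWires F
  ps = Vec.take m os
  qs = Vec.drop m os
  split : wiresCode os ≡ wiresCode ps ++ wiresCode qs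
  split = trans (cong wiresCode (sym (take++drop≡id m os))) (wiresCode-++ ps qs)
  counter : ∀ {s} → lookup s 6F ≡ ones m [] → lookup s 3F ≡ [] →
    transfer 6F 3F ⊢ s ⇓[ ⟦ loop var (const 4) ⟧ n ]
      updateAt (updateAt s 6F (λ _ → [])) 3F (λ _ → List.replicate m true)
  counter {s} eq eq₃ = weaken (rounds-mono (≤-trans (≤-reflexive (length-ones m)) m≤n) ≤-refl) (transfer-⇓ (λ ()) _ eq)
    ▸ updateAt-cong-local 3F (updateAt s 6F _) (trans (cong (ones m [] ʳ++_) (trans (lookup∘updateAt′ 3F 6F (λ ()) s) eq₃)) (ones-moved m))
  main = (⇓-then-transfer {e = xorStart} {n} (λ ()) refl
      ( (copyCircuit-⇓ I ≤n ▸ at 0F split)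
      ⨾ weaken (rounds-mono m≤n ≤-refl) (storeWires-⇓ ps (endWidth≤ F ≤n)))
      ▸ at 5F (trans (ʳ++-ʳ++ (wiresCode ps)) (++-identityʳ (wiresCode ps))))
    ⨾ counter refl refl
    ⨾ (weaken (rounds-mono m≤n ≤-refl) (writeBlocks-⇓ 0 ps qs (+-identityʳ m) (endWidth≤ F ≤n) m+0≤n))
    ⨾ emit-⇓ 2F (false ∷ [])
    ⨾ counter refl refl
    ⨾ weaken (rounds-mono m≤n ≤-refl) (writeXorWires-⇓ 0 m {endWidth F} m+0≤n)
  code : natsCode (Vec.map toℕ (xorWires m {endWidth F})) ʳ++ (false ∷
           gatesCode (xorBlocks 0 ps qs (+-identityʳ m)) ʳ++ ((unary m ++ gatesCode F) ʳ++ [])) ≡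
         (unary m ++ circuitCode (xorHalves F)) ʳ++ []
  code rewrite circuitCode-mapOutputs (xorOutputs {m}) F
             | circuitCode-end (xorBlocks 0 ps qs (+-identityʳ m))
             | endWires-xorBlocks 0 ps qs (+-identityʳ m)
             | wiresCode-nats (xorWires m {endWidth F}) =
    sym (trans (cong (_ʳ++ []) (sym (++-assoc (unary m) (gatesCode F) _)))
        (trans (++-ʳ++ (unary m ++ gatesCode F)) (++-ʳ++ (gatesCode (xorBlocks 0 ps qs (+-identityʳ m))))))

transfer-≤ : ∀ {k n} {i j : Fin k} → i ≢ j → ∀ {s w} → lookup s i ≡ w → length w ≤ n →
  transfer i j ⊢ s ⇓[ ⟦ loop var (const 4) ⟧ n ] updateAt (updateAt s i (λ _ → [])) j (w ʳ++_)
transfer-≤ i≢j eq len≤n = weaken (rounds-mono len≤n ≤-refl) (transfer-⇓ i≢j _ eq)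

double-ʳ++ : ∀ (w : String) {v} → (w ʳ++ []) ʳ++ v ≡ w ++ v
double-ʳ++ w = ʳ++-ʳ++ w

length-reversed : ∀ (w : String) → length (w ʳ++ []) ≡ length w
length-reversed w = trans (length-ʳ++ w) (+-identityʳ _)

candidate≤ : ∀ c d → length d ≤ totalLength (c ∷ d ∷ [])
candidate≤ c d = ≤-trans (≤-reflexive (sym (+-identityʳ _))) (m≤n+m _ (length c))

-- The candidate maps; stack 0 is the instance, stack 1 the candidate and stack 2 the output

unpadProg : Prog 4
unpadProg = case 1F (λ
  { nothing      → skip
  ; (just false) → moveTop 1F 3F ⨾ transfer 1F 3F
  ; (just true)  → moveTop 1F 3F ⨾ pop 1F ⨾ transfer 1F 3F })
  ⨾ transfer 3F 2F

unpadB : Bound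
unpadB = (const 6 ⊕ loop var (const 4)) ⊕ loop var (const 4)

unpadProg-⇓ : ∀ {m} c (x : EKRCandidate m) → ∃[ s ]
  (unpadProg ⊢ c ∷ ekrCode x ∷ [] ∷ [] ∷ [] ⇓[ ⟦ unpadB ⟧ (totalLength (c ∷ ekrCode x ∷ [])) ] s
  × lookup s 2F ≡ collisionCode (unpad x))
unpadProg-⇓ c x@(invalid i) = _ ,
  (weaken (+-monoˡ-≤ _ (m≤m+n 5 1)) (case (case (pop ⨾ push) ⨾ transfer-≤ {n = n} (λ ()) refl (≤-trans (n≤1+n _) len≤)))
   ⨾ transfer-≤ (λ ()) refl (≤-trans (≤-reflexive (length-reversed (collisionCode (unpad x)))) len≤)) ,
  trans (double-ʳ++ (collisionCode (unpad x))) (++-identityʳ _)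
  where
  n = totalLength (c ∷ ekrCode x ∷ [])
  len≤ : length (collisionCode (unpad x)) ≤ n
  len≤ = candidate≤ c (ekrCode x)
unpadProg-⇓ c x@(repeated i j) = _ ,
  ((case (case (pop ⨾ push) ⨾ pop ⨾ transfer-≤ {n = n} (λ ()) refl (≤-trans (n≤1+n _) len≤)))
   ⨾ transfer-≤ (λ ()) refl (≤-trans (≤-reflexive (length-reversed (collisionCode (unpad x)))) len≤)) ,
  trans (double-ʳ++ (collisionCode (unpad x))) (++-identityʳ _)
  where
  n = totalLength (c ∷ ekrCode x ∷ [])
  len≤ : length (collisionCode (unpad x)) ≤ n
  len≤ = ≤-trans (n≤1+n _) (candidate≤ c (ekrCode x))
unpadProg-⇓ c x@(disjoint i j) = _ ,
  ((case (case (pop ⨾ push) ⨾ pop ⨾ transfer-≤ {n = n} (λ ()) refl (≤-trans (n≤1+n _) len≤)))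
   ⨾ transfer-≤ (λ ()) refl (≤-trans (≤-reflexive (length-reversed (collisionCode (unpad x)))) len≤)) ,
  trans (double-ʳ++ (collisionCode (unpad x))) (++-identityʳ _)
  where
  n = totalLength (c ∷ ekrCode x ∷ [])
  len≤ : length (collisionCode (unpad x)) ≤ n
  len≤ = ≤-trans (n≤1+n _) (candidate≤ c (ekrCode x))

-- Simultaneous evaluation of a circuit on two inputs. Stacks 3 and 4 hold the values of the wires,
-- stacks 7 and 8 the operands of the current gate.

copyTop : ∀ {k} → Fin k → Fin k → Prog k
copyTop i j = case i λ { (just b) → push j b ; nothing → skip }

-- The newest wire is on top, so a unary wire number says how many values to set aside before the
-- wanted one is exposed. Since reading the code consumes it, both inputs are handled in the same
-- pass.
descend : ∀ {k} → Prog (9 + k)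
descend = while 0F isTrue (pop 0F ⨾ moveTop 3F 5F ⨾ moveTop 4F 6F)

fetch : ∀ {k} → Prog (9 + k)
fetch = descend ⨾ pop 0F ⨾ copyTop 3F 7F ⨾ copyTop 4F 8F ⨾ transfer 5F 3F ⨾ transfer 6F 4F

fetchB : Bound
fetchB = loop var (const 9) ⊕ const 7 ⊕ loop var (const 4) ⊕ loop var (const 4)

above below : ∀ {w} → Fin w → BitVec w → String
above zero    _       = []
above (suc v) (b ∷ ρ) = b ∷ above v ρ
below zero    (b ∷ ρ) = toList ρ
below (suc v) (b ∷ ρ) = below v ρ

above-below : ∀ {w} (v : Fin w) ρ → above v ρ ++ lookup ρ v ∷ below v ρ ≡ toList ρ
above-below zero    (b ∷ ρ) = refl
above-below (suc v) (b ∷ ρ) = cong (b ∷_) (above-below v ρ)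

length-above : ∀ {w} (v : Fin w) ρ → length (above v ρ) ≡ toℕ v
length-above zero    ρ       = refl
length-above (suc v) (b ∷ ρ) = cong suc (length-above v ρ)

descend-⇓ : ∀ {k w} (v : Fin w) ρ₁ ρ₂ {r d o T₁ T₂ V₁ V₂} {s : Vec String k} →
  descend ⊢ (wireCode v ++ r) ∷ d ∷ o ∷ toList ρ₁ ∷ toList ρ₂ ∷ T₁ ∷ T₂ ∷ V₁ ∷ V₂ ∷ s ⇓[ rounds (toℕ v) 9 ]
    (false ∷ r) ∷ d ∷ o ∷ (lookup ρ₁ v ∷ below v ρ₁) ∷ (lookup ρ₂ v ∷ below v ρ₂) ∷
    (above v ρ₁ ʳ++ T₁) ∷ (above v ρ₂ ʳ++ T₂) ∷ V₁ ∷ V₂ ∷ s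
descend-⇓ zero    (_ ∷ _)  (_ ∷ _)  = stop refl
descend-⇓ (suc v) (_ ∷ ρ₁) (_ ∷ ρ₂) = loop refl (pop ⨾ case (pop ⨾ push) ⨾ case (pop ⨾ push)) (descend-⇓ v ρ₁ ρ₂)

unop : ∀ {k} → (Bool → Bool) → Fin k → Fin k → Prog k
unop f i j = case i λ { (just a) → pop i ⨾ push j (f a) ; nothing → skip }

binop : ∀ {k} → (Bool → Bool → Bool) → Fin k → Fin k → Prog k
binop f i j = case i λ
  -- The operand fetched last is on top, so the second argument comes off first.
  { (just b) → pop i ⨾ case i λ { (just a) → pop i ⨾ push j (f a b) ; nothing → skip }
  ; nothing  → skip }

gateProg : ∀ {k} → Prog (9 + k)
gateProg = case 0F λ
  { nothing      → skip
  ; (just false) → pop 0F ⨾ case 0F λ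
      { nothing      → skip
      ; (just false) → pop 0F ⨾ case 0F λ
          { nothing → skip ; (just b) → pop 0F ⨾ push 3F b ⨾ push 4F b }
      ; (just true)  → pop 0F ⨾ fetch ⨾ unop Bool.not 7F 3F ⨾ unop Bool.not 8F 4F }
  ; (just true)  → pop 0F ⨾ case 0F λ
      { nothing      → skip
      ; (just false) → pop 0F ⨾ fetch ⨾ fetch ⨾ binop Bool._∧_ 7F 3F ⨾ binop Bool._∧_ 8F 4F
      ; (just true)  → pop 0F ⨾ fetch ⨾ fetch ⨾ binop Bool._∨_ 7F 3F ⨾ binop Bool._∨_ 8F 4F } }

gateProgB : Bound
gateProgB = const 4 ⊕ fetchB ⊕ fetchB ⊕ const 12

gatesProg : ∀ {k} → Prog (9 + k)
gatesProg = while 0F isTrue (pop 0F ⨾ gateProg)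

module _ {n : ℕ} where

  fetch-⇓ : ∀ {k w} (v : Fin w) ρ₁ ρ₂ {r d o V₁ V₂} {s : Vec String k} → w ≤ n →
    fetch ⊢ (wireCode v ++ r) ∷ d ∷ o ∷ toList ρ₁ ∷ toList ρ₂ ∷ [] ∷ [] ∷ V₁ ∷ V₂ ∷ s ⇓[ ⟦ fetchB ⟧ n ]
      r ∷ d ∷ o ∷ toList ρ₁ ∷ toList ρ₂ ∷ [] ∷ [] ∷ (lookup ρ₁ v ∷ V₁) ∷ (lookup ρ₂ v ∷ V₂) ∷ s
  fetch-⇓ v ρ₁ ρ₂ w≤n =
    weaken (rounds-mono (toℕ≤ v w≤n) ≤-refl) (descend-⇓ v ρ₁ ρ₂)
    ⨾ pop ⨾ case push ⨾ case push
    ⨾ (transfer-≤ (λ ()) refl (length≤ ρ₁) ▸ at 3F (restored ρ₁))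
    ⨾ (transfer-≤ (λ ()) refl (length≤ ρ₂) ▸ at 4F (restored ρ₂))
    where
    length≤ : ∀ ρ → length (above v ρ ʳ++ []) ≤ n
    length≤ ρ = ≤-trans (≤-reflexive (trans (length-reversed (above v ρ)) (length-above v ρ))) (toℕ≤ v w≤n)
    restored : ∀ ρ → (above v ρ ʳ++ []) ʳ++ (lookup ρ v ∷ below v ρ) ≡ toList ρ
    restored ρ = trans (double-ʳ++ (above v ρ)) (above-below v ρ)

  gateProg-⇓ : ∀ {k w} (g : Gate w) ρ₁ ρ₂ {r d o} {s : Vec String k} → w ≤ n →
    gateProg ⊢ (gateCode g ++ r) ∷ d ∷ o ∷ toList ρ₁ ∷ toList ρ₂ ∷ [] ∷ [] ∷ [] ∷ [] ∷ s ⇓[ ⟦ gateProgB ⟧ n ]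
      r ∷ d ∷ o ∷ toList (evalGate g ρ₁ ∷ ρ₁) ∷ toList (evalGate g ρ₂ ∷ ρ₂) ∷ [] ∷ [] ∷ [] ∷ [] ∷ s
  gateProg-⇓ (const b) ρ₁ ρ₂ w≤n =
    weaken (+-monoʳ-≤ 4 (≤-trans (m≤m+n 6 6) (≤-trans (m≤n+m 12 _) (m≤n+m _ (⟦ fetchB ⟧ n)))))
      (case (pop ⨾ case (pop ⨾ case (pop ⨾ push ⨾ push))))
  gateProg-⇓ (not v) ρ₁ ρ₂ w≤n =
    weaken (+-monoʳ-≤ 4 (+-monoʳ-≤ (⟦ fetchB ⟧ n) (≤-trans (m≤m+n 8 4) (m≤n+m 12 _))))
      (case (pop ⨾ case (pop ⨾ fetch-⇓ v ρ₁ ρ₂ w≤n ⨾ case (pop ⨾ push) ⨾ case (pop ⨾ push))))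
  gateProg-⇓ (and u v) ρ₁ ρ₂ {r} w≤n rewrite ++-assoc (wireCode u) (wireCode v) r =
    case (pop ⨾ case (pop ⨾ fetch-⇓ u ρ₁ ρ₂ w≤n ⨾ fetch-⇓ v ρ₁ ρ₂ w≤n ⨾
      case (pop ⨾ case (pop ⨾ push)) ⨾ case (pop ⨾ case (pop ⨾ push))))
  gateProg-⇓ (or u v)  ρ₁ ρ₂ {r} w≤n rewrite ++-assoc (wireCode u) (wireCode v) r =
    case (pop ⨾ case (pop ⨾ fetch-⇓ u ρ₁ ρ₂ w≤n ⨾ fetch-⇓ v ρ₁ ρ₂ w≤n ⨾
      case (pop ⨾ case (pop ⨾ push)) ⨾ case (pop ⨾ case (pop ⨾ push))))

  gatesProg-⇓ : ∀ {k w m} (C : Circuit w m) ρ₁ ρ₂ {d o} {s : Vec String k} → w + size C ≤ n →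
    gatesProg ⊢ circuitCode C ∷ d ∷ o ∷ toList ρ₁ ∷ toList ρ₂ ∷ [] ∷ [] ∷ [] ∷ [] ∷ s
      ⇓[ rounds (size C) (1 + ⟦ gateProgB ⟧ n) ]
      (false ∷ wiresCode (endWires C)) ∷ d ∷ o ∷ toList (endEnv C ρ₁) ∷ toList (endEnv C ρ₂) ∷
      [] ∷ [] ∷ [] ∷ [] ∷ s
  gatesProg-⇓ (outputs os) ρ₁ ρ₂ _ = stop refl
  gatesProg-⇓ (g ▹ C) ρ₁ ρ₂ w≤n =
    loop refl (pop ⨾ gateProg-⇓ g ρ₁ ρ₂ (≤-trans (m≤m+n _ _) w≤n))
         (gatesProg-⇓ C (evalGate g ρ₁ ∷ ρ₁) (evalGate g ρ₂ ∷ ρ₂) (≤-trans (≤-reflexive (sym (+-suc _ _))) w≤n))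

-- The remaining stacks: 9 the reversed candidate, 10 and 11 counters, 12 and 13 the first half
-- of the output on the first input, 14 and 15 the mismatches.

flag : ∀ {k} → Fin k → Bool → Prog k
flag i true  = push i true
flag i false = skip

flag-⇓ : ∀ {k} (i : Fin k) b {s} →
         flag i b ⊢ s ⇓[ 2 ] updateAt s i (λ w → if b then true ∷ w else w)
flag-⇓ i true  = push
flag-⇓ i false {s} = weaken (s≤s z≤n) skip ▸ sym (updateAt-id-local i s refl)

compare : ∀ {k} → Fin k → Fin k → Fin k → Prog k
compare i j e = case i λ
  { nothing  → skip
  ; (just a) → pop i ⨾ case j λ { nothing → skip ; (just b) → pop j ⨾ flag e (a xor b) } }

readBit : Fin 16 → Prog 16
readBit i = case 1F λ { nothing → skip ; (just b) → pop 1F ⨾ push i b ⨾ push 9F b }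

-- The candidate joins two indices without a separator; the unary n at the front of the instance
-- tells where the first one ends.
readFirst readSecond readInputs firstHalf secondHalf answer : Prog 16
readFirst  = while 0F isTrue (pop 0F ⨾ readBit 5F ⨾ push (# 10) true) ⨾ pop 0F
readSecond = while 1F is-just (readBit 6F)
readInputs = readFirst ⨾ readSecond ⨾ transfer 5F 3F ⨾ transfer 6F 4F
firstHalf  = while (# 10) is-just
  (pop (# 10) ⨾ fetch ⨾ copyTop 7F (# 12) ⨾ compare 7F 8F (# 14) ⨾ push (# 11) true)
-- `fetch` yields a bit of y and a bit of y′; the former is discarded and the saved x is compared
-- with y′.
secondHalf = while (# 10) is-just (pop (# 10) ⨾ fetch ⨾ pop 7F ⨾ compare (# 13) 8F (# 15))
answer     = case (# 14) λ
  { nothing  → push 2F false ⨾ push 2F true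
  ; (just _) → case (# 15) λ
      { nothing  → push 2F false ⨾ push 2F true
      ; (just _) → push 2F true ⨾ push 2F true } }

decideProg : Prog 16
decideProg = pop 1F ⨾ readInputs ⨾ gatesProg ⨾ pop 0F ⨾ firstHalf ⨾ transfer (# 12) (# 13) ⨾ transfer (# 11) (# 10)
  ⨾ secondHalf ⨾ transfer 9F 2F ⨾ answer

unxorProg : Prog 16
unxorProg = case 1F λ
  { nothing      → skip
  ; (just false) → moveTop 1F 9F ⨾ transfer 1F 9F ⨾ transfer 9F 2F
  ; (just true)  → decideProg }

readInputsB decideB unxorB : Bound
readInputsB = (loop var (const 9) ⊕ const 1) ⊕ loop var (const 6) ⊕ loop var (const 4) ⊕ loop var (const 4)
decideB = const 1 ⊕ readInputsB ⊕ loop var (const 1 ⊕ gateProgB) ⊕ const 1 ⊕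
  loop var (const 1 ⊕ fetchB ⊕ const 11) ⊕ loop var (const 4) ⊕ loop var (const 4) ⊕
  loop var (const 1 ⊕ fetchB ⊕ const 7) ⊕ loop var (const 4) ⊕ const 6
unxorB = const 1 ⊕ (const 4 ⊕ loop var (const 4) ⊕ loop var (const 4)) ⊕ decideB

readFirst-⇓ : ∀ {m} (x : BitVec m) {r c o W₁ W₂ T₂ V₁ V₂ s} →
  readFirst ⊢ (unary m ++ r) ∷ (toList x ++ c) ∷ o ∷ W₁ ∷ W₂ ∷ [] ∷ T₂ ∷ V₁ ∷ V₂ ∷ [] ∷ [] ∷ s
    ⇓[ rounds m 9 + 1 ]
    r ∷ c ∷ o ∷ W₁ ∷ W₂ ∷ (toList x ʳ++ []) ∷ T₂ ∷ V₁ ∷ V₂ ∷ (toList x ʳ++ []) ∷ List.replicate m true ∷ s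
readFirst-⇓ {m} x rewrite sym (ones-replicate m) = loops x ⨾ pop
  where
  loops : ∀ {m} (x : BitVec m) {r c o W₁ W₂ T₁ T₂ V₁ V₂ R N s} →
    while 0F isTrue (pop 0F ⨾ readBit 5F ⨾ push (# 10) true) ⊢
      (unary m ++ r) ∷ (toList x ++ c) ∷ o ∷ W₁ ∷ W₂ ∷ T₁ ∷ T₂ ∷ V₁ ∷ V₂ ∷ R ∷ N ∷ s
      ⇓[ rounds m 9 ]
      (false ∷ r) ∷ c ∷ o ∷ W₁ ∷ W₂ ∷ (toList x ʳ++ T₁) ∷ T₂ ∷ V₁ ∷ V₂ ∷ (toList x ʳ++ R) ∷ ones m N ∷ s
  loops []      = stop refl
  loops (_ ∷ x) = loop refl (pop ⨾ case (pop ⨾ push ⨾ push) ⨾ push) (loops x)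

readSecond-⇓ : ∀ {m} (x : BitVec m) {i o W₁ W₂ T₁ T₂ V₁ V₂ R s} →
  readSecond ⊢ i ∷ toList x ∷ o ∷ W₁ ∷ W₂ ∷ T₁ ∷ T₂ ∷ V₁ ∷ V₂ ∷ R ∷ s ⇓[ rounds m 6 ]
    i ∷ [] ∷ o ∷ W₁ ∷ W₂ ∷ T₁ ∷ (toList x ʳ++ T₂) ∷ V₁ ∷ V₂ ∷ (toList x ʳ++ R) ∷ s
readSecond-⇓ []      = stop refl
readSecond-⇓ (_ ∷ x) = loop refl (case (pop ⨾ push ⨾ push)) (readSecond-⇓ x)

readInputs-⇓ : ∀ {m n} (x y : BitVec m) {r o s} → m ≤ n →
  readInputs ⊢ (unary m ++ r) ∷ (toList x ++ toList y) ∷ o ∷ [] ∷ [] ∷ [] ∷ [] ∷ [] ∷ [] ∷ [] ∷ [] ∷ s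
    ⇓[ ⟦ readInputsB ⟧ n ]
    r ∷ [] ∷ o ∷ toList x ∷ toList y ∷ [] ∷ [] ∷ [] ∷ [] ∷ ((toList x ++ toList y) ʳ++ []) ∷
    List.replicate m true ∷ s
readInputs-⇓ {m} {n} x y m≤n rewrite ++-ʳ++ (toList x) {toList y} {[]} =
  weaken (+-monoˡ-≤ 1 (rounds-mono m≤n ≤-refl)) (readFirst-⇓ x)
  ⨾ weaken (rounds-mono m≤n ≤-refl) (readSecond-⇓ y)
  ⨾ (transfer-≤ (λ ()) refl (length≤ x) ▸ at 3F (restored x))
  ⨾ (transfer-≤ (λ ()) refl (length≤ y) ▸ at 4F (restored y))
  where
  length≤ : (z : BitVec m) → length (toList z ʳ++ []) ≤ n
  length≤ z = ≤-trans (≤-reflexive (trans (length-reversed (toList z)) (length-toList z))) m≤n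
  restored : (z : BitVec m) → (toList z ʳ++ []) ʳ++ [] ≡ toList z
  restored z = trans (double-ʳ++ (toList z)) (++-identityʳ _)

firstHalf-⇓ : ∀ {n w m} (os : Vec (Fin w) m) ρ₁ ρ₂ {r c o R M X Y E₁ s} → w ≤ n →
  firstHalf ⊢ (wiresCode os ++ r) ∷ c ∷ o ∷ toList ρ₁ ∷ toList ρ₂ ∷ [] ∷ [] ∷ [] ∷ [] ∷
      R ∷ List.replicate m true ∷ M ∷ X ∷ Y ∷ E₁ ∷ s ⇓[ rounds m (⟦ const 1 ⊕ fetchB ⊕ const 11 ⟧ n) ]
    r ∷ c ∷ o ∷ toList ρ₁ ∷ toList ρ₂ ∷ [] ∷ [] ∷ [] ∷ [] ∷
      R ∷ [] ∷ ones m M ∷ (toList (Vec.map (lookup ρ₁) os) ʳ++ X) ∷ Y ∷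
      mismatches (Vec.map (lookup ρ₁) os) (Vec.map (lookup ρ₂) os) E₁ ∷ s
firstHalf-⇓ []       ρ₁ ρ₂ _ = stop refl
firstHalf-⇓ (v ∷ os) ρ₁ ρ₂ {r} w≤n rewrite ++-assoc (wireCode v) (wiresCode os) r =
  loop refl
    (pop ⨾ fetch-⇓ v ρ₁ ρ₂ w≤n ⨾ case push ⨾
      case (pop ⨾ case (pop ⨾ flag-⇓ (# 14) (lookup ρ₁ v xor lookup ρ₂ v))) ⨾ push)
    (firstHalf-⇓ os ρ₁ ρ₂ w≤n)

secondHalf-⇓ : ∀ {n w m} (os : Vec (Fin w) m) (x : BitVec m) ρ₁ ρ₂ {c o R M X E₁ E₂} → w ≤ n →
  secondHalf ⊢ wiresCode os ∷ c ∷ o ∷ toList ρ₁ ∷ toList ρ₂ ∷ [] ∷ [] ∷ [] ∷ [] ∷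
      R ∷ List.replicate m true ∷ M ∷ X ∷ toList x ∷ E₁ ∷ E₂ ∷ []
      ⇓[ rounds m (⟦ const 1 ⊕ fetchB ⊕ const 7 ⟧ n) ]
    [] ∷ c ∷ o ∷ toList ρ₁ ∷ toList ρ₂ ∷ [] ∷ [] ∷ [] ∷ [] ∷
      R ∷ [] ∷ M ∷ X ∷ [] ∷ E₁ ∷ mismatches x (Vec.map (lookup ρ₂) os) E₂ ∷ []
secondHalf-⇓ []       []      ρ₁ ρ₂ _ = stop refl
secondHalf-⇓ (v ∷ os) (b ∷ x) ρ₁ ρ₂ w≤n =
  loop refl
    (pop ⨾ fetch-⇓ v ρ₁ ρ₂ w≤n ⨾ pop ⨾ case (pop ⨾ case (pop ⨾ flag-⇓ (# 15) (b xor lookup ρ₂ v))))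
    (secondHalf-⇓ os x ρ₁ ρ₂ w≤n)

answer-⇓ : ∀ {m} (x y : BitVec m) e₁ e₂ {i c W₁ W₂ T₁ T₂ V₁ V₂ R N M X Y} → ∃[ s ]
  (answer ⊢ i ∷ c ∷ (toList x ++ toList y) ∷ W₁ ∷ W₂ ∷ T₁ ∷ T₂ ∷ V₁ ∷ V₂ ∷ R ∷ N ∷ M ∷ X ∷ Y ∷ e₁ ∷ e₂ ∷ []
     ⇓[ 6 ] s × lookup s 2F ≡ ekrCode (verdict e₁ e₂ x y))
answer-⇓ x y []       e₂       = _ , weaken (m≤m+n 5 1) (case (push ⨾ push)) , refl
answer-⇓ x y (_ ∷ _)  []       = _ , case (case (push ⨾ push)) , refl
answer-⇓ x y (_ ∷ _)  (_ ∷ _)  = _ , case (case (push ⨾ push)) , refl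

decideProg-⇓ : ∀ {p n} (I : BoundedCircuit (λ m → m + m) p) → let open BoundedCircuit I renaming (n to m) in
  (x y : BitVec m) → m + size circuit ≤ n → length (toList x ++ toList y) ≤ n → ∃[ s ]
  (decideProg ⊢ boundedCode I ∷ collisionCode (collide x y) ∷ replicate 14 [] ⇓[ ⟦ decideB ⟧ n ] s
  × lookup s 2F ≡ ekrCode (unxor circuit (collide x y)))
decideProg-⇓ {n = n} (bounded m F _) x y ≤n length≤
  with s , d , eq ← answer-⇓ x y (mismatches (Vec.map (lookup (endEnv F x)) (Vec.take m (endWires F)))
                                             (Vec.map (lookup (endEnv F y)) (Vec.take m (endWires F))) [])
                                 (mismatches (Vec.map (lookup (endEnv F x)) (Vec.take m (endWires F)))
                                             (Vec.map (lookup (endEnv F y)) (Vec.drop m (endWires F))) []) =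
  s , (pop
  ⨾ readInputs-⇓ x y m≤n
  ⨾ (weaken (rounds-mono (m+n≤o⇒n≤o m ≤n) ≤-refl) (gatesProg-⇓ F x y ≤n))
  ⨾ (pop ▸ at 0F split)
  ⨾ weaken (rounds-mono m≤n ≤-refl) (firstHalf-⇓ us ρ₁ ρ₂ w≤n)
  ⨾ (transfer-≤ (λ ()) refl (≤-trans (≤-reflexive (trans (length-reversed (toList z)) (length-toList z))) m≤n)
     ▸ at (# 13) (trans (double-ʳ++ (toList z)) (++-identityʳ _)))
  ⨾ (transfer-≤ (λ ()) refl (≤-trans (≤-reflexive (length-ones m)) m≤n) ▸ at (# 10) (ones-moved m))
  ⨾ weaken (rounds-mono m≤n ≤-refl) (secondHalf-⇓ vs z ρ₁ ρ₂ w≤n)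
  ⨾ (transfer-≤ (λ ()) refl (≤-trans (≤-reflexive (length-reversed (toList x ++ toList y))) length≤)
     ▸ at 2F (trans (double-ʳ++ (toList x ++ toList y)) (++-identityʳ _)))
  ⨾ d) ,
  trans eq (cong₂ (λ P Q → ekrCode (verdict (mismatches (proj₁ P) (proj₁ Q) []) (mismatches (proj₁ P) (proj₂ Q) []) x y))
                  (sym (evalPair-end F x)) (sym (evalPair-end F y)))
  where
  m≤n = m+n≤o⇒m≤o m ≤n
  w≤n = endWidth≤ F ≤n
  ρ₁ = endEnv F x
  ρ₂ = endEnv F y
  us = Vec.take m (endWires F)
  vs = Vec.drop m (endWires F)
  z = Vec.map (lookup ρ₁) us
  split : wiresCode (endWires F) ≡ wiresCode us ++ wiresCode vs
  split = trans (cong wiresCode (sym (take++drop≡id m (endWires F)))) (wiresCode-++ us vs)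

unxorProg-⇓ : ∀ {p} (I : BoundedCircuit (λ m → m + m) p) → let open BoundedCircuit I renaming (n to m) in
  (x : CollisionCandidate m) → ∃[ s ]
  (unxorProg ⊢ boundedCode I ∷ collisionCode x ∷ replicate 14 []
     ⇓[ ⟦ unxorB ⟧ (totalLength (boundedCode I ∷ collisionCode x ∷ [])) ] s
  × lookup s 2F ≡ ekrCode (unxor circuit x))
unxorProg-⇓ I c@(preimage x) = _ ,
  weaken (s≤s (m≤m+n _ _))
    (case (case (pop ⨾ push)
      ⨾ transfer-≤ {n = n} (λ ()) refl (≤-trans (n≤1+n _) len≤)
      ⨾ transfer-≤ (λ ()) refl (≤-trans (≤-reflexive (length-reversed (collisionCode c))) len≤))) ,
  trans (double-ʳ++ (collisionCode c)) (++-identityʳ _)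
  where
  n = totalLength (boundedCode I ∷ collisionCode c ∷ [])
  len≤ : length (collisionCode c) ≤ n
  len≤ = candidate≤ (boundedCode I) (collisionCode c)
unxorProg-⇓ I c@(collide x y)
  with s , d , eq ← decideProg-⇓ {n = totalLength (boundedCode I ∷ collisionCode c ∷ [])} I x y
         (≤-trans (instance-width I) (+-monoʳ-≤ (length (boundedCode I)) z≤n))
         (≤-trans (n≤1+n _) (candidate≤ (boundedCode I) (collisionCode c))) =
  s , weaken (s≤s (m≤n+m _ (⟦ const 4 ⊕ loop var (const 4) ⊕ loop var (const 4) ⟧ n))) (case d) , eq
  where
  n = totalLength (boundedCode I ∷ collisionCode c ∷ [])

-- The two reductions

collision≼ekr : Collision ≼ ErdősKoRado
collision≼ekr p = p +ₚ (1 ∷ []) , record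
  { f          = padBounded
  ; g          = λ _ → unpad
  ; f-polyTime = polyTime (λ I → boundedCode I ∷ []) padProg padB padProg-⇓
  ; g-polyTime = polyTime (λ (I , s) → boundedCode I ∷ ekrCode s ∷ []) unpadProg unpadB
                   (λ (I , s) → unpadProg-⇓ (boundedCode I) s)
  ; g-correct  = λ I → unpad-correct (BoundedCircuit.circuit I)
  }

ekr≼collision : ErdősKoRado ≼ Collision
ekr≼collision p = p +ₚ (0 ∷ 6 ∷ []) , record
  { f          = xorBounded
  ; g          = λ I → unxor (BoundedCircuit.circuit I)
  ; f-polyTime = polyTime (λ I → boundedCode I ∷ []) (xorProg ⨾ transfer 2F 1F) xorB xorProg-⇓
  ; g-polyTime = polyTime (λ (I , s) → boundedCode I ∷ collisionCode s ∷ []) unxorProg unxorB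
                   (λ (I , s) → unxorProg-⇓ I s)
  ; g-correct  = λ I → unxor-correct (BoundedCircuit.circuit I)
  }

theorem10 : PPP-complete ErdősKoRado
theorem10 = collision≼ekr , ekr≼collision
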